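{- There exist $2^{\aleph_0}$ path-minimal non-prime graphs whose ages are pairwise incomparable with respect to set inclusion and each well-quasi-ordered under embeddability, and such that every graph equimorphic to any of these graphs is also non-prime.
   Context: Graphs are simple, undirected, loopless. A graph embeds in another if it is isomorphic to an induced subgraph; two graphs are equimorphic if each embeds in the other. The age of a graph is the class of finite graphs embedding in it; it is well-quasi-ordered if it contains no infinite antichain. A path is a graph whose vertices can be injectively mapped into an interval of $\mathbb{Z}$ so that adjacency means images differing by $1$; its length is its number of vertices minus one. A graph $G$ is path-minimal if for every $n$ it has an induced subgraph which is a finite path of length at least $n$, and every induced subgraph of $G$ with this property embeds $G$. A module of $G=(V,E)$ is a set $A\subseteq V$ such that every $v\notin A$ is adjacent to all or to none of the vertices of $A$; $\emptyset$, singletons and $V$ are trivial modules. $G$ is prime if it has more than three vertices and all its modules are trivial. -}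

module Defs where

open import Data.Nat using (ℕ; zero; suc; _≤_)
open import Data.Nat.Properties using (suc-injective)
open import Data.Fin using (Fin; toℕ)
open import Data.Bool using (Bool)
open import Data.Product using (Σ; ∃; ∃-syntax; _×_; _,_; proj₁)
open import Data.Sum using (_⊎_; inj₁; inj₂)
open import Data.Empty using (⊥)
open import Relation.Nullary using (¬_)
open import Relation.Binary.PropositionalEquality using (_≡_; _≢_; refl; sym; trans)

record Graph : Set₁ where
  field
    V     : Set
    E     : V → V → Set
    symE  : ∀ x y → E x y → E y x
    irrE  : ∀ x → ¬ E x x
open Graph public

record Embedding (G H : Graph) : Set where
  field
    f     : V G → V H
    inj   : ∀ x y → f x ≡ f y → x ≡ y
    pres  : ∀ x y → E G x y → E H (f x) (f y)
    refl' : ∀ x y → E H (f x) (f y) → E G x y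

Embeds : Graph → Graph → Set
Embeds G H = Embedding G H

Equimorphic : Graph → Graph → Set
Equimorphic G H = Embeds G H × Embeds H G

record FinGraph : Set₁ where
  field
    n     : ℕ
    Ef    : Fin n → Fin n → Set
    symEf : ∀ x y → Ef x y → Ef y x
    irrEf : ∀ x → ¬ Ef x x

toGraph : FinGraph → Graph
toGraph F = record { V = Fin (FinGraph.n F) ; E = FinGraph.Ef F
                   ; symE = FinGraph.symEf F ; irrE = FinGraph.irrEf F }

InAge : Graph → FinGraph → Set
InAge G F = Embeds (toGraph F) G

AgeSubset : Graph → Graph → Set₁
AgeSubset G H = ∀ (F : FinGraph) → InAge G F → InAge H F

InfiniteAntichainInAge : Graph → Set₁
InfiniteAntichainInAge G =
  Σ (ℕ → FinGraph) λ A →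
    (∀ i → InAge G (A i)) ×
    (∀ i j → i ≢ j → ¬ Embeds (toGraph (A i)) (toGraph (A j)))

AgeWQO : Graph → Set₁
AgeWQO G = ¬ InfiniteAntichainInAge G

PathAdj : ∀ {m} → Fin m → Fin m → Set
PathAdj i j = (toℕ i ≡ suc (toℕ j)) ⊎ (toℕ j ≡ suc (toℕ i))

private
  n≢sn : ∀ n → n ≢ suc n
  n≢sn zero ()
  n≢sn (suc n) eq = n≢sn n (suc-injective eq)

PathGraph : ℕ → Graph
PathGraph m = record
  { V = Fin (suc m) ; E = PathAdj
  ; symE = λ { x y (inj₁ p) → inj₂ p ; x y (inj₂ p) → inj₁ p }
  ; irrE = λ { x (inj₁ p) → n≢sn _ p ; x (inj₂ p) → n≢sn _ p } }

HasLongPaths : Graph → Set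
HasLongPaths G = ∀ (n : ℕ) → ∃[ m ] (n ≤ m × Embeds (PathGraph m) G)

IsPropPred : {A : Set} → (A → Set) → Set
IsPropPred {A} S = ∀ x (p q : S x) → p ≡ q

Induced : (G : Graph) → (V G → Set) → Graph
Induced G S = record
  { V = Σ (V G) S ; E = λ x y → E G (proj₁ x) (proj₁ y)
  ; symE = λ x y → symE G (proj₁ x) (proj₁ y)
  ; irrE = λ x → irrE G (proj₁ x) }

PathMinimal : Graph → Set₁
PathMinimal G =
  HasLongPaths G ×
  (∀ (S : V G → Set) → IsPropPred S →
     HasLongPaths (Induced G S) → Embeds G (Induced G S))

-- Modules: every vertex outside A is adjacent to all or to none of A,
-- i.e. no vertex outside A has both a neighbour and a non-neighbour in A.
IsModule : (G : Graph) → (V G → Set) → Set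
IsModule G A = ∀ v → ¬ A v →
  ¬ (Σ (V G) λ a → Σ (V G) λ b → A a × A b × E G v a × ¬ E G v b)

TrivialModule : (G : Graph) → (V G → Set) → Set
TrivialModule G A =
  (∀ x → ¬ A x) ⊎
  (∃[ x ] (∀ y → (A y → y ≡ x) × (y ≡ x → A y))) ⊎
  (∀ x → A x)

MoreThanThree : Graph → Set
MoreThanThree G = Σ (Fin 4 → V G) λ g → ∀ i j → g i ≡ g j → i ≡ j

Prime : Graph → Set₁
Prime G = MoreThanThree G × (∀ (A : V G → Set) → IsModule G A → TrivialModule G A)

-- Cantor-space index (2^ℵ₀ many indices), distinctness as apartness.
Apart : (ℕ → Bool) → (ℕ → Bool) → Set
Apart s t = ∃[ k ] (s k ≢ t k)

{-# OPTIONS --safe #-}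
module Submission where

-- Level i of the graph is a path on i vertices labelled by a prefix of a word w, and a
-- vertex is joined to all lower levels if its label is true and to none of them
-- otherwise. So the levels ≤ j form a module, also in every induced subgraph. In an
-- induced path, the upper end of an edge between distinct levels is adjacent to every
-- lower vertex, so two such edges cannot be far apart; hence a long induced path contains
-- a long interval of one level. If w is uniformly recurrent, such intervals contain
-- copies of all levels, which gives path-minimality. Two long paths on distinct levels
-- exhibit a factor of w, so ages remember the factors of w. Finite induced subgraphs are
-- lists of lists of factors of w, factors of a uniformly recurrent word are
-- well-quasi-ordered, and Higman's lemma is applied twice.
-- The words are Toeplitz words, in which the letter c k occupies the positions n with
-- v₂ (n + 1) = k; long factors of such a word, or their reverses, determine c k as soon
-- as c has no three equal consecutive letters, which is why s is encoded as
-- s 0, ¬ s 0, s 1, ¬ s 1, …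

open import Defs
open import Data.Bool using (Bool; true; false; not; _≟_)
open import Data.Bool.Properties using (not-¬)
open import Data.Empty using (⊥; ⊥-elim)
open import Data.Fin using (Fin; zero; suc; fromℕ<; inject≤; splitAt; join; _↑ˡ_; _↑ʳ_) renaming (toℕ to toℕᶠ)
open import Data.Fin.Properties using (toℕ-fromℕ<; fromℕ<-toℕ; toℕ<n; toℕ-inject≤; splitAt-↑ˡ; splitAt-↑ʳ; join-splitAt; any?) renaming (toℕ-injective to toℕᶠ-injective; _≟_ to _≟ᶠ_)
open import Data.List using (List; []; _∷_; _++_; length; foldr)
open import Data.List.Relation.Binary.Sublist.Heterogeneous using (Sublist; []; _∷_; _∷ʳ_; minimum)
open import Data.List.Relation.Binary.Sublist.Heterogeneous.Properties using (sublist?; ++⁺; ++ˡ)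
open import Data.List.Relation.Unary.All using (All; []; _∷_)
open import Data.Nat using (ℕ; zero; suc; _+_; _*_; _∸_; _^_; _≤_; _<_; z≤n; s≤s; _⊔_)
open import Data.Nat.Properties renaming (_≟_ to _≟ⁿ_)
open import Data.Nat.Binary using (ℕᵇ; zero; 2[1+_]; 1+[2_]; fromℕ)
open import Data.Nat.Binary.Properties using (toℕ-injective; toℕ-fromℕ)
open import Data.Nat.Tactic.RingSolver using (solve-∀)
open import Data.Product using (Σ; ∃; ∃-syntax; _×_; _,_; proj₁; proj₂)
open import Data.Product.Properties using (≡-dec)
open import Data.Sum using (_⊎_; inj₁; inj₂; [_,_]′; swap)
open import Data.Sum.Relation.Binary.Pointwise using (Pointwise; inj₁; inj₂)
open import Data.Unit using (⊤; tt)
open import Function using (id; _∘_)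
open import Level using (0ℓ)
open import Relation.Binary.Core using (Rel)
open import Relation.Binary.Definitions using (Decidable; tri<; tri≈; tri>)
open import Relation.Nullary using (¬_; Dec; yes; no)
open import Relation.Nullary.Decidable using (_×-dec_; _⊎-dec_; ¬?; decidable-stable)
open import Relation.Binary.PropositionalEquality using (_≡_; _≢_; refl; sym; trans; cong; subst; subst₂; module ≡-Reasoning)

-- Almost-full relations and their closure under intersections, sums and products.

Relation : Set → Set₁
Relation X = Rel X 0ℓ

-- Almost-full relations: the constructive form of "every sequence x₀, x₁, …
-- has i < j with R xᵢ xⱼ".
data AF {X : Set} (R : Relation X) : Set where
  now   : (∀ x y → R x y) → AF R
  later : (∀ a → AF (λ x y → R x y ⊎ R a x)) → AF R

AF-map : ∀ {X Y} {R : Relation X} {S : Relation Y} (f : Y → X) →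
         (∀ x y → R (f x) (f y) → S x y) → AF R → AF S
AF-map f h (now r)   = now λ x y → h x y (r (f x) (f y))
AF-map f h (later p) = later λ a → AF-map f
  (λ { x y (inj₁ r) → inj₁ (h x y r) ; x y (inj₂ r) → inj₂ (h a x r) }) (p (f a))

AF-⇒ : ∀ {X} {R S : Relation X} → (∀ x y → R x y → S x y) → AF R → AF S
AF-⇒ = AF-map id

AF-good-pair : ∀ {X} {R : Relation X} → AF R → (x : ℕ → X) → ∃[ i ] ∃[ j ] (i < j × R (x i) (x j))
AF-good-pair (now r) x = 0 , 1 , s≤s z≤n , r _ _
AF-good-pair (later p) x with AF-good-pair (p (x 0)) (x ∘ suc)
... | i , j , i<j , inj₁ r = suc i , suc j , s≤s i<j , r
... | i , j , i<j , inj₂ r = 0 , suc i , s≤s z≤n , r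

-- The intersection theorem, following Vytiniotis, Coquand and Wahlstedt, by way
-- of the variants in which the common part is a constant or a unary predicate.
AF-∩₀ : ∀ {X} {R S C : Relation X} {A B : Set} → AF R → AF S →
        (∀ x y → R x y → C x y ⊎ A) → (∀ x y → S x y → C x y ⊎ B) →
        AF (λ x y → C x y ⊎ (A × B))
AF-∩₀ {S = S} {C} {A} {B} (now r) q h k = AF-⇒ g q
  where
  g : ∀ x y → S x y → C x y ⊎ (A × B)
  g x y s with h x y (r x y) | k x y s
  ... | inj₁ c | _      = inj₁ c
  ... | inj₂ _ | inj₁ c = inj₁ c
  ... | inj₂ a | inj₂ b = inj₂ (a , b)
AF-∩₀ {R = R} {S} {C} {A} {B} (later p) q h k = later λ a → AF-⇒ (g a) (AF-∩₀ (p a) q (h′ a) (k′ a))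
  where
  C′ : _ → _ → _ → Set
  C′ a x y = C x y ⊎ C a x
  h′ : ∀ a x y → R x y ⊎ R a x → C′ a x y ⊎ A
  h′ a x y (inj₁ r) with h x y r
  ... | inj₁ c = inj₁ (inj₁ c)
  ... | inj₂ d = inj₂ d
  h′ a x y (inj₂ r) with h a x r
  ... | inj₁ c = inj₁ (inj₂ c)
  ... | inj₂ d = inj₂ d
  k′ : ∀ a x y → S x y → C′ a x y ⊎ B
  k′ a x y s with k x y s
  ... | inj₁ c = inj₁ (inj₁ c)
  ... | inj₂ d = inj₂ d
  g : ∀ a x y → C′ a x y ⊎ (A × B) → (C x y ⊎ (A × B)) ⊎ (C a x ⊎ (A × B))
  g a x y (inj₁ (inj₁ c)) = inj₁ (inj₁ c)
  g a x y (inj₁ (inj₂ c)) = inj₂ (inj₁ c)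
  g a x y (inj₂ d)        = inj₁ (inj₂ d)

-- At a point `a`, advancing the first derivation costs an extra disjunct `A a`, advancing the
-- second an extra `B a`. Both are constants, so `AF-∩₀` merges the two results, leaving
-- `A a × B a`.
AF-∩₁ : ∀ {X} {R S C : Relation X} {A B : X → Set} → AF R → AF S →
        (∀ x y → R x y → C x y ⊎ A x) → (∀ x y → S x y → C x y ⊎ B x) →
        AF (λ x y → C x y ⊎ (A x × B x))
AF-∩₁ {S = S} {C} {A} {B} (now r) q h k = AF-⇒ g q
  where
  g : ∀ x y → S x y → C x y ⊎ (A x × B x)
  g x y s with h x y (r x y) | k x y s
  ... | inj₁ c | _      = inj₁ c
  ... | inj₂ _ | inj₁ c = inj₁ c
  ... | inj₂ a | inj₂ b = inj₂ (a , b)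
AF-∩₁ {R = R} {C = C} {A} {B} p@(later _) (now s) h k = AF-⇒ g p
  where
  g : ∀ x y → R x y → C x y ⊎ (A x × B x)
  g x y r with h x y r | k x y (s x y)
  ... | inj₁ c | _      = inj₁ c
  ... | inj₂ _ | inj₁ c = inj₁ c
  ... | inj₂ a | inj₂ b = inj₂ (a , b)
AF-∩₁ {R = R} {S} {C} {A} {B} (later p) (later q) h k = later λ a → AF-⇒ (g a)
  (AF-∩₀ {C = C₀ a} {A = A a} {B = B a}
    (AF-∩₁ {C = λ x y → (C x y ⊎ C a x) ⊎ A a} (p a) (later q) (h₁ a) (k₁ a))
    (AF-∩₁ {C = λ x y → (C x y ⊎ C a x) ⊎ B a} (later p) (q a) (h₂ a) (k₂ a))
    (λ { x y (inj₁ (inj₁ c)) → inj₁ (inj₁ c) ; x y (inj₁ (inj₂ c)) → inj₂ c ; x y (inj₂ c) → inj₁ (inj₂ c) })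
    (λ { x y (inj₁ (inj₁ c)) → inj₁ (inj₁ c) ; x y (inj₁ (inj₂ c)) → inj₂ c ; x y (inj₂ c) → inj₁ (inj₂ c) }))
  where
  C₀ : _ → _ → _ → Set
  C₀ a x y = (C x y ⊎ C a x) ⊎ (A x × B x)
  h₁ : ∀ a x y → R x y ⊎ R a x → ((C x y ⊎ C a x) ⊎ A a) ⊎ A x
  h₁ a x y (inj₁ r) with h x y r
  ... | inj₁ c = inj₁ (inj₁ (inj₁ c))
  ... | inj₂ d = inj₂ d
  h₁ a x y (inj₂ r) with h a x r
  ... | inj₁ c = inj₁ (inj₁ (inj₂ c))
  ... | inj₂ d = inj₁ (inj₂ d)
  k₁ : ∀ a x y → S x y → ((C x y ⊎ C a x) ⊎ A a) ⊎ B x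
  k₁ a x y s with k x y s
  ... | inj₁ c = inj₁ (inj₁ (inj₁ c))
  ... | inj₂ d = inj₂ d
  h₂ : ∀ a x y → R x y → ((C x y ⊎ C a x) ⊎ B a) ⊎ A x
  h₂ a x y r with h x y r
  ... | inj₁ c = inj₁ (inj₁ (inj₁ c))
  ... | inj₂ d = inj₂ d
  k₂ : ∀ a x y → S x y ⊎ S a x → ((C x y ⊎ C a x) ⊎ B a) ⊎ B x
  k₂ a x y (inj₁ s) with k x y s
  ... | inj₁ c = inj₁ (inj₁ (inj₁ c))
  ... | inj₂ d = inj₂ d
  k₂ a x y (inj₂ s) with k a x s
  ... | inj₁ c = inj₁ (inj₁ (inj₂ c))
  ... | inj₂ d = inj₁ (inj₂ d)
  g : ∀ a x y → C₀ a x y ⊎ (A a × B a) → (C x y ⊎ (A x × B x)) ⊎ (C a x ⊎ (A a × B a))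
  g a x y (inj₁ (inj₁ (inj₁ c))) = inj₁ (inj₁ c)
  g a x y (inj₁ (inj₁ (inj₂ c))) = inj₂ (inj₁ c)
  g a x y (inj₁ (inj₂ d))        = inj₁ (inj₂ d)
  g a x y (inj₂ d)               = inj₂ (inj₂ d)

-- The same scheme one arity higher: advancing one side at `a` leaves the unary remainder `R a` or
-- `S a`, and `AF-∩₁` merges the two.
AF-∩ : ∀ {X} {R S : Relation X} → AF R → AF S → AF (λ x y → R x y × S x y)
AF-∩ (now r) q = AF-⇒ (λ x y s → r x y , s) q
AF-∩ p@(later _) (now s) = AF-⇒ (λ x y r → r , s x y) p
AF-∩ {R = R} {S} (later p) (later q) = later λ a →
  AF-∩₁ {A = R a} {B = S a} (AF-∩ (p a) (later q)) (AF-∩ (later p) (q a))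
    (λ { x y (inj₁ r , s) → inj₁ (r , s) ; x y (inj₂ r , s) → inj₂ r })
    (λ { x y (r , inj₁ s) → inj₁ (r , s) ; x y (r , inj₂ s) → inj₂ s })

AF-≤ : AF _≤_
AF-≤ = later λ a → below a a ≤-refl
  where
  -- `a` is the fuel: a next term `c` either lies above `b`, which settles the relation, or becomes
  -- the new, strictly smaller bound.
  below : ∀ a b → b ≤ a → AF (λ x y → x ≤ y ⊎ b ≤ x)
  below zero    zero z≤n = now λ x y → inj₂ z≤n
  below (suc a) b b≤a = later step
    where
    step : ∀ c → AF (λ x y → (x ≤ y ⊎ b ≤ x) ⊎ (c ≤ x ⊎ b ≤ c))
    step c with ≤-<-connex b c
    ... | inj₁ b≤c = now λ x y → inj₂ (inj₂ b≤c)
    ... | inj₂ c<b = AF-⇒ (λ { x y (inj₁ r) → inj₁ (inj₁ r) ; x y (inj₂ r) → inj₂ (inj₁ r) })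
                          (below a c (≤-pred (≤-trans c<b b≤a)))

-- Pigeonhole: two of `a`, `b` and `x` agree.
AF-Bool : AF (_≡_ {A = Bool})
AF-Bool = later λ a → later λ b → now (total a b)
  where
  total : ∀ a b x y → (x ≡ y ⊎ a ≡ x) ⊎ (b ≡ x ⊎ a ≡ b)
  total true  true  _     _ = inj₂ (inj₂ refl)
  total false false _     _ = inj₂ (inj₂ refl)
  total true  false true  _ = inj₁ (inj₂ refl)
  total true  false false _ = inj₂ (inj₁ refl)
  total false true  true  _ = inj₂ (inj₁ refl)
  total false true  false _ = inj₁ (inj₂ refl)

module _ {A B : Set} where

  OnLeft : Relation A → Relation (A ⊎ B)
  OnLeft R (inj₁ x) (inj₁ y) = R x y
  OnLeft R _        _        = ⊤

  OnRight : Relation B → Relation (A ⊎ B)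
  OnRight S (inj₂ x) (inj₂ y) = S x y
  OnRight S _        _        = ⊤

  isLeft : A ⊎ B → Bool
  isLeft (inj₁ _) = true
  isLeft (inj₂ _) = false

  AF-OnLeft : ∀ {R} → AF R → AF (OnLeft R)
  AF-OnLeft (now r) = now λ { (inj₁ x) (inj₁ y) → r x y ; (inj₁ _) (inj₂ _) → tt ; (inj₂ _) _ → tt }
  AF-OnLeft {R} (later p) = later λ
    { (inj₁ a) → AF-⇒ (λ { (inj₁ x) (inj₁ y) r → r ; (inj₁ _) (inj₂ _) _ → inj₁ tt ; (inj₂ _) _ _ → inj₁ tt })
                      (AF-OnLeft (p a))
    ; (inj₂ _) → now λ x y → inj₂ tt }

  AF-OnRight : ∀ {S} → AF S → AF (OnRight S)
  AF-OnRight (now s) = now λ { (inj₂ x) (inj₂ y) → s x y ; (inj₂ _) (inj₁ _) → tt ; (inj₁ _) _ → tt }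
  AF-OnRight {S} (later p) = later λ
    { (inj₂ a) → AF-⇒ (λ { (inj₂ x) (inj₂ y) s → s ; (inj₂ _) (inj₁ _) _ → inj₁ tt ; (inj₁ _) _ _ → inj₁ tt })
                      (AF-OnRight (p a))
    ; (inj₁ _) → now λ x y → inj₂ tt }

  -- The pointwise relation on a sum is the intersection of equality of tags with two relations that
  -- are trivial off their own summand.
  AF-⊎ : ∀ {R S} → AF R → AF S → AF (Pointwise R S)
  AF-⊎ {R} {S} p q = AF-⇒ g (AF-∩ (AF-map isLeft (λ _ _ e → e) AF-Bool) (AF-∩ (AF-OnLeft p) (AF-OnRight q)))
    where
    g : ∀ x y → isLeft x ≡ isLeft y × OnLeft R x y × OnRight S x y → Pointwise R S x y
    g (inj₁ _) (inj₁ _) (_ , r , _) = inj₁ r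
    g (inj₂ _) (inj₂ _) (_ , _ , s) = inj₂ s
    g (inj₁ _) (inj₂ _) (() , _)
    g (inj₂ _) (inj₁ _) (() , _)

AF-× : ∀ {A B} {R : Relation A} {S : Relation B} → AF R → AF S →
       AF (λ (x y : A × B) → R (proj₁ x) (proj₁ y) × S (proj₂ x) (proj₂ y))
AF-× p q = AF-∩ (AF-map proj₁ (λ _ _ r → r) p) (AF-map proj₂ (λ _ _ s → s) q)

-- Higman's lemma.

total⇒Sublist : ∀ {X} {R : Relation X} → (∀ x y → R x y) →
                ∀ u v → length u ≤ length v → Sublist R u v
total⇒Sublist r []      v       _       = minimum v
total⇒Sublist r (x ∷ u) (y ∷ v) (s≤s h) = r x y ∷ total⇒Sublist r u v h

-- Words that avoid the word a ∷ w are either words over the letters that do not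
-- dominate a, or split at the first letter dominating a, with a tail that avoids w.
-- Hence they are a sum of products of sequences already known to be well behaved.
module _ {X : Set} {R : Relation X} (R? : Decidable R) where

  Split : Set
  Split = List X ⊎ (List X × X × List X)

  data Splits (a : X) : List X → Split → Set where
    avoid : ∀ {u} → All (¬_ ∘ R a) u → Splits a u (inj₁ u)
    hit   : ∀ {u b v} → All (¬_ ∘ R a) u → R a b → Splits a (u ++ b ∷ v) (inj₂ (u , b , v))

  splitAtFirst : ∀ a u → ∃ (Splits a u)
  splitAtFirst a [] = _ , avoid []
  splitAtFirst a (b ∷ u) with R? a b
  ... | yes r = _ , hit [] r
  ... | no ¬r with splitAtFirst a u
  ...   | _ , avoid ns = _ , avoid (¬r ∷ ns)
  ...   | _ , hit ns r = _ , hit (¬r ∷ ns) r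

  Sublist-avoid : ∀ {a u v} → All (¬_ ∘ R a) u → Sublist (λ x y → R x y ⊎ R a x) u v → Sublist R u v
  Sublist-avoid []        []            = []
  Sublist-avoid ns        (y ∷ʳ s)      = y ∷ʳ Sublist-avoid ns s
  Sublist-avoid (n ∷ ns) (inj₁ r ∷ s) = r ∷ Sublist-avoid ns s
  Sublist-avoid (n ∷ ns) (inj₂ r ∷ s) = ⊥-elim (n r)

  Higman-step : ∀ {a w} → AF (Sublist (λ x y → R x y ⊎ R a x)) → AF R →
                AF (λ u v → Sublist R u v ⊎ Sublist R w u) →
                AF (λ u v → Sublist R u v ⊎ Sublist R (a ∷ w) u)
  Higman-step {a} {w} pₐ p q = AF-map (proj₁ ∘ splitAtFirst a) combine (AF-⊎ pₐ (AF-× pₐ (AF-× p q)))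
    where
    T : Relation Split
    T = Pointwise (Sublist (λ x y → R x y ⊎ R a x))
        (λ x y → Sublist (λ x y → R x y ⊎ R a x) (proj₁ x) (proj₁ y) × R (proj₁ (proj₂ x)) (proj₁ (proj₂ y)) ×
                 (Sublist R (proj₂ (proj₂ x)) (proj₂ (proj₂ y)) ⊎ Sublist R w (proj₂ (proj₂ x))))
    combine′ : ∀ {u v s t} → Splits a u s → Splits a v t → T s t → Sublist R u v ⊎ Sublist R (a ∷ w) u
    combine′ (avoid ns) (avoid _) (inj₁ s) = inj₁ (Sublist-avoid ns s)
    combine′ (hit ns _) (hit _ _) (inj₂ (s , r , inj₁ t)) = inj₁ (++⁺ (Sublist-avoid ns s) (r ∷ t))
    combine′ (hit {u} _ r) (hit _ _) (inj₂ (_ , _ , inj₂ t)) = inj₂ (++ˡ u (r ∷ t))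
    combine : ∀ u v → T (proj₁ (splitAtFirst a u)) (proj₁ (splitAtFirst a v)) →
              Sublist R u v ⊎ Sublist R (a ∷ w) u
    combine u v = combine′ (proj₂ (splitAtFirst a u)) (proj₂ (splitAtFirst a v))

-- Outer induction on the derivation for `R`, inner induction on the word `w` to be avoided. A total
-- `R` reduces the claim to comparing lengths. Decidability travels along because each residue is
-- split at a first dominating letter.
Higman : ∀ {X} {R : Relation X} → Decidable R → AF R → AF (Sublist R)
Higman R? (now r) = AF-map length (total⇒Sublist r) AF-≤
Higman {R = R} R? (later p) = later residue
  where
  residue : ∀ w → AF (λ u v → Sublist R u v ⊎ Sublist R w u)
  residue []      = now λ u v → inj₂ (minimum u)
  residue (a ∷ w) = Higman-step R? (Higman (λ x y → R? x y ⊎-dec R? a x) (p a)) (later p) (residue w)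

-- Toeplitz words

Seq : Set
Seq = ℕ → Bool

data Parity : ℕ → Set where
  even : ∀ m → Parity (m + m)
  odd  : ∀ m → Parity (suc (m + m))

parity : ∀ n → Parity n
parity zero = even 0
parity (suc n) with parity n
... | even m = odd m
... | odd m  = subst Parity (cong suc (+-suc m m)) (even (suc m))

double-injective : ∀ a b → a + a ≡ b + b → a ≡ b
double-injective zero    zero    _ = refl
double-injective (suc a) (suc b) e = cong suc (double-injective a b
  (suc-injective (trans (sym (+-suc a a)) (trans (suc-injective e) (+-suc b b)))))

double≢suc-double : ∀ a b → a + a ≢ suc (b + b)
double≢suc-double (suc a) b e =
  double≢suc-double b a (trans (sym (suc-injective e)) (+-suc a a))

double-cancel-< : ∀ a b → a + a < b + b → a < b
double-cancel-< a b h with ≤-<-connex b a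
... | inj₁ b≤a = ⊥-elim (<⇒≱ h (+-mono-≤ b≤a b≤a))
... | inj₂ a<b = a<b

double-+ : ∀ m i → m + m + (i + i) ≡ m + i + (m + i)
double-+ = solve-∀

double-+-suc : ∀ m i → m + m + suc (i + i) ≡ suc (m + i + (m + i))
double-+-suc = solve-∀

2^suc : ∀ K → 2 ^ suc K ≡ 2 ^ K + 2 ^ K
2^suc K = cong (2 ^ K +_) (+-identityʳ (2 ^ K))

n<2^n : ∀ n → n < 2 ^ n
n<2^n zero    = s≤s z≤n
n<2^n (suc n) = subst (suc n <_) (sym (2^suc n)) (+-mono-≤ (≤-trans (s≤s z≤n) (n<2^n n)) (n<2^n n))

double<2^suc : ∀ K {i} → i < 2 ^ K → i + i < 2 ^ suc K
double<2^suc K {i} i< = subst (i + i <_) (sym (2^suc K)) (+-mono-< i< i<)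

suc-double<2^suc : ∀ K {i} → i < 2 ^ K → suc (i + i) < 2 ^ suc K
suc-double<2^suc K {i} i< = subst₂ _≤_ (cong suc (+-suc i i)) (sym (2^suc K)) (+-mono-≤ i< i<)

-- With positions shifted by one, the n-th letter of this Toeplitz word is c (v₂ n),
-- where v₂ is the 2-adic valuation.
toeplitzᵇ : Seq → ℕᵇ → Bool
toeplitzᵇ c zero     = c 0
toeplitzᵇ c 2[1+ x ] = c 0
toeplitzᵇ c 1+[2 x ] = toeplitzᵇ (c ∘ suc) x

toeplitz : Seq → ℕ → Bool
toeplitz c n = toeplitzᵇ c (fromℕ n)

fromℕ-even : ∀ m → fromℕ (suc m + suc m) ≡ 2[1+ fromℕ m ]
fromℕ-even m = toℕ-injective (trans (toℕ-fromℕ (suc m + suc m)) (trans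
  (cong (suc m +_) (sym (+-identityʳ (suc m)))) (cong (λ k → 2 * suc k) (sym (toℕ-fromℕ m)))))

fromℕ-odd : ∀ m → fromℕ (suc (m + m)) ≡ 1+[2 fromℕ m ]
fromℕ-odd m = toℕ-injective (trans (toℕ-fromℕ (suc (m + m))) (cong suc (trans
  (cong (m +_) (sym (+-identityʳ m))) (cong (2 *_) (sym (toℕ-fromℕ m))))))

toeplitz-even : ∀ c m → toeplitz c (m + m) ≡ c 0
toeplitz-even c zero    = refl
toeplitz-even c (suc m) = cong (toeplitzᵇ c) (fromℕ-even m)

toeplitz-odd : ∀ c m → toeplitz c (suc (m + m)) ≡ toeplitz (c ∘ suc) m
toeplitz-odd c m = cong (toeplitzᵇ c) (fromℕ-odd m)

toeplitz-even′ : ∀ c {n} m → n ≡ m + m → toeplitz c n ≡ c 0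
toeplitz-even′ c m refl = toeplitz-even c m

toeplitz-odd′ : ∀ c {n} m → n ≡ suc (m + m) → toeplitz c n ≡ toeplitz (c ∘ suc) m
toeplitz-odd′ c m refl = toeplitz-odd c m

-- Adding a multiple of `2 ^ K` to a positive number below `2 ^ K` keeps its 2-adic valuation; that
-- number is `suc x` because positions are shifted by one.
toeplitz-period : ∀ K c x m → suc x < 2 ^ K → toeplitz c (x + m * 2 ^ K) ≡ toeplitz c x
toeplitz-period zero    c x m (s≤s ())
toeplitz-period (suc K) c x m h with parity x
... | even y = trans (toeplitz-even′ c (y + m * 2 ^ K) (lemma y m (2 ^ K))) (sym (toeplitz-even c y))
  where
  lemma : ∀ y m N → y + y + m * (2 * N) ≡ (y + m * N) + (y + m * N)
  lemma = solve-∀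
... | odd y = trans (toeplitz-odd′ c (y + m * 2 ^ K) (lemma y m (2 ^ K)))
                    (trans (toeplitz-period K (c ∘ suc) y m bound) (sym (toeplitz-odd c y)))
  where
  lemma : ∀ y m N → suc (y + y) + m * (2 * N) ≡ suc ((y + m * N) + (y + m * N))
  lemma = solve-∀
  bound : suc y < 2 ^ K
  bound = double-cancel-< (suc y) (2 ^ K) (subst₂ _<_ (cong suc (sym (+-suc y y))) (2^suc K) h)

-- Two positive numbers with sum `2 ^ K` have the same 2-adic valuation. Hence reversed factors are
-- factors, and paths traversed backwards can be turned around.
toeplitz-mirror : ∀ K c x y → suc x + suc y ≡ 2 ^ K → toeplitz c x ≡ toeplitz c y
toeplitz-mirror zero c x y e with trans (sym (+-suc x y)) (suc-injective e)
... | ()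
toeplitz-mirror (suc K) c x y e with parity x | parity y
... | even a | even b = trans (toeplitz-even c a) (sym (toeplitz-even c b))
... | odd a  | odd b  = trans (toeplitz-odd c a) (trans
  (toeplitz-mirror K (c ∘ suc) a b (double-injective (suc a + suc b) (2 ^ K)
    (trans (lemma a b) (trans e (2^suc K))))) (sym (toeplitz-odd c b)))
  where
  lemma : ∀ a b → (suc a + suc b) + (suc a + suc b) ≡ suc (suc (a + a)) + suc (suc (b + b))
  lemma = solve-∀
... | even a | odd b  = ⊥-elim (double≢suc-double (2 ^ K) (suc (a + b)) (trans (sym (2^suc K)) (trans (sym e) (lemma a b))))
  where
  lemma : ∀ a b → suc (a + a) + suc (suc (b + b)) ≡ suc (suc (a + b) + suc (a + b))
  lemma = solve-∀
... | odd a  | even b = ⊥-elim (double≢suc-double (2 ^ K) (suc (a + b)) (trans (sym (2^suc K)) (trans (sym e) (lemma a b))))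
  where
  lemma : ∀ a b → suc (suc (a + a)) + suc (b + b) ≡ suc (suc (a + b) + suc (a + b))
  lemma = solve-∀

multiple-above : ∀ N q → ∃[ M ] ∃[ d ] (M * suc N ≡ q + d × d ≤ suc N)
multiple-above N zero = 0 , 0 , refl , z≤n
multiple-above N (suc q) with multiple-above N q
... | M , suc d , e , d≤N = M , d , trans e (+-suc q d) , ≤-trans (n≤1+n d) d≤N
... | M , zero  , e , _   = suc M , N , trans (cong (suc N +_) e) (lemma N q) , n≤1+n N
  where
  lemma : ∀ N q → suc N + (q + 0) ≡ suc q + N
  lemma = solve-∀

-- The factor at `p` ends before the period `2 ^ (p + l)` is exhausted, so it recurs at `p` plus any
-- multiple of the period, and some multiple lies at most one period above `q`.
toeplitz-recurrent : ∀ c p l → ∃[ B ] (∀ q → ∃[ r ] (r + l ≤ B ×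
                     (∀ {a} → a < l → toeplitz c (p + a) ≡ toeplitz c (q + (r + a)))))
toeplitz-recurrent c p l = p + 2 ^ (p + l) + l , occurrence
  where
  K = p + l
  occurrence : ∀ q → ∃[ r ] (r + l ≤ p + 2 ^ K + l × (∀ {a} → a < l → toeplitz c (p + a) ≡ toeplitz c (q + (r + a))))
  occurrence q with 2 ^ K in eqN
  ... | zero = ⊥-elim (<⇒≱ (n<2^n K) (subst (_≤ K) (sym eqN) z≤n))
  ... | suc N with multiple-above N q
  ...   | M , d , e , d≤N = p + d , +-monoˡ-≤ l (+-monoʳ-≤ p d≤N) , λ {a} a<l →
    trans (sym (toeplitz-period K c (p + a) M (≤-<-trans (+-monoʳ-< p a<l) (n<2^n K))))
          (cong (toeplitz c) (trans (cong (p + a +_) (trans (cong (M *_) eqN) e)) (lemma p a q d)))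
    where
    lemma : ∀ p a q d → p + a + (q + d) ≡ q + (p + d + a)
    lemma = solve-∀

-- The positions assigned to `c k` form a residue class modulo `2 ^ suc k`.
toeplitz-hits : ∀ k c q → ∃[ i ] (i < 2 ^ suc k × toeplitz c (q + i) ≡ c k)
toeplitz-hits zero c q with parity q
... | even m = 0 , s≤s z≤n , toeplitz-even′ c m (+-identityʳ (m + m))
... | odd m  = 1 , s≤s (s≤s z≤n) , toeplitz-even′ c (suc m) (lemma m)
  where
  lemma : ∀ m → suc (m + m) + 1 ≡ suc m + suc m
  lemma = solve-∀
toeplitz-hits (suc k) c q with parity q
... | even m with toeplitz-hits k (c ∘ suc) m
...   | i , i< , e = suc (i + i) , suc-double<2^suc (suc k) i< , trans (toeplitz-odd′ c (m + i) (double-+-suc m i)) e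
toeplitz-hits (suc k) c q | odd m with toeplitz-hits k (c ∘ suc) m
...   | i , i< , e = i + i , double<2^suc (suc k) i< , trans (toeplitz-odd′ c (m + i) (cong suc (double-+ m i))) e

NoTripleRepeat : Seq → Set
NoTripleRepeat c = ∀ k → ¬ (c k ≡ c (1 + k) × c k ≡ c (2 + k))

-- Eight is `2 ^ 3`: such a window meets positions of `c 0`, `c 1` and `c 2`, which are not all
-- equal.
toeplitz-not-constant : ∀ {c} → NoTripleRepeat c → ∀ q b → ¬ (∀ i → i < 8 → toeplitz c (q + i) ≡ b)
toeplitz-not-constant {c} nt q b const with toeplitz-hits 0 c q | toeplitz-hits 1 c q | toeplitz-hits 2 c q
... | i , i< , e | j , j< , e′ | k , k< , e″ = nt 0
  ( trans (sym e) (trans (const i (≤-trans i< (s≤s (s≤s z≤n)))) (trans (sym (const j (≤-trans j< (s≤s (s≤s (s≤s (s≤s z≤n))))))) e′))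
  , trans (sym e) (trans (const i (≤-trans i< (s≤s (s≤s z≤n)))) (trans (sym (const k k<)) e″)))

toeplitz-hits-true : ∀ {c} → NoTripleRepeat c → ∀ q → ∃[ i ] (i < 8 × toeplitz c (q + i) ≡ true)
toeplitz-hits-true {c} nt q with anyUpTo? (λ i → toeplitz c (q + i) ≟ true) 8
... | yes h = h
... | no ¬h = ⊥-elim (toeplitz-not-constant nt q false (λ i i< → ¬true⇒false _ (λ e → ¬h (i , i< , e))))
  where
  ¬true⇒false : ∀ b → b ≢ true → b ≡ false
  ¬true⇒false true  h = ⊥-elim (h refl)
  ¬true⇒false false h = refl

-- The position of the hole (the letters of the tail) modulo 2 is forced, because the
-- other residue class carries a constant word.
toeplitz-match : ∀ k {c d} → NoTripleRepeat c → NoTripleRepeat d → ∀ p q →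
                 (∀ i → i < 2 ^ (4 + k) → toeplitz c (p + i) ≡ toeplitz d (q + i)) → c k ≡ d k
toeplitz-match k {c} {d} ntc ntd p q h with parity p | parity q
-- Sixteen letters are needed to see eight letters of the tail of `d`, which would all equal `c 0`.
-- The exponent `4 + k` leaves sixteen letters even after `k` halvings.
... | even p′ | odd q′ = ⊥-elim (toeplitz-not-constant (ntd ∘ suc) q′ (c 0) λ i i<8 →
  trans (sym (toeplitz-odd′ d (q′ + i) (cong suc (double-+ q′ i))))
        (trans (sym (h (i + i) (<-≤-trans (double<2^suc 3 i<8) (^-monoʳ-≤ 2 (m≤m+n 4 k)))))
               (toeplitz-even′ c (p′ + i) (double-+ p′ i))))
... | odd p′ | even q′ = ⊥-elim (toeplitz-not-constant (ntc ∘ suc) p′ (d 0) λ i i<8 →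
  trans (sym (toeplitz-odd′ c (p′ + i) (cong suc (double-+ p′ i))))
        (trans (h (i + i) (<-≤-trans (double<2^suc 3 i<8) (^-monoʳ-≤ 2 (m≤m+n 4 k))))
               (toeplitz-even′ d (q′ + i) (double-+ q′ i))))
toeplitz-match zero {c} {d} ntc ntd p q h | even p′ | even q′ =
  trans (sym (toeplitz-even′ c p′ (+-identityʳ _))) (trans (h 0 (s≤s z≤n)) (toeplitz-even′ d q′ (+-identityʳ _)))
toeplitz-match zero {c} {d} ntc ntd p q h | odd p′ | odd q′ =
  trans (sym (toeplitz-even′ c (suc p′) (lemma p′)))
        (trans (h 1 (s≤s (s≤s z≤n))) (toeplitz-even′ d (suc q′) (lemma q′)))
  where
  lemma : ∀ m → suc (m + m) + 1 ≡ suc m + suc m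
  lemma = solve-∀
toeplitz-match (suc k) {c} {d} ntc ntd p q h | even p′ | even q′ =
  toeplitz-match k (ntc ∘ suc) (ntd ∘ suc) p′ q′ λ i i< →
    trans (sym (toeplitz-odd′ c (p′ + i) (double-+-suc p′ i)))
          (trans (h (suc (i + i)) (suc-double<2^suc (4 + k) i<)) (toeplitz-odd′ d (q′ + i) (double-+-suc q′ i)))
toeplitz-match (suc k) {c} {d} ntc ntd p q h | odd p′ | odd q′ =
  toeplitz-match k (ntc ∘ suc) (ntd ∘ suc) p′ q′ λ i i< →
    trans (sym (toeplitz-odd′ c (p′ + i) (cong suc (double-+ p′ i))))
          (trans (h (i + i) (double<2^suc (4 + k) i<)) (toeplitz-odd′ d (q′ + i) (cong suc (double-+ q′ i))))

interleave¬ : Seq → Seq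
interleave¬ s zero          = s 0
interleave¬ s (suc zero)    = not (s 0)
interleave¬ s (suc (suc n)) = interleave¬ (s ∘ suc) n

interleave¬-even : ∀ s k → interleave¬ s (k + k) ≡ s k
interleave¬-even s zero    = refl
interleave¬-even s (suc k) = trans (cong (interleave¬ s ∘ suc) (+-suc k k)) (interleave¬-even (s ∘ suc) k)

interleave¬-noTriple : ∀ s → NoTripleRepeat (interleave¬ s)
interleave¬-noTriple s zero          (e , _)  = not-¬ refl e
interleave¬-noTriple s (suc zero)    (e , e′) = not-¬ refl (trans (sym e) e′)
interleave¬-noTriple s (suc (suc k)) h        = interleave¬-noTriple (s ∘ suc) k h

-- Layered graphs and their induced paths

Consecutive : ℕ → ℕ → Set
Consecutive k l = k ≡ suc l ⊎ l ≡ suc k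

consecutive-irreflexive : ∀ {k} → ¬ Consecutive k k
consecutive-irreflexive (inj₁ e) = 1+n≢n (sym e)
consecutive-irreflexive (inj₂ e) = 1+n≢n (sym e)

consecutive-no-triangle : ∀ {a b c} → Consecutive a b → Consecutive a c → ¬ Consecutive b c
consecutive-no-triangle (inj₁ refl) (inj₁ refl) = consecutive-irreflexive
consecutive-no-triangle (inj₂ refl) (inj₂ refl) = consecutive-irreflexive
consecutive-no-triangle (inj₁ refl) (inj₂ refl) (inj₁ ())
consecutive-no-triangle (inj₁ refl) (inj₂ refl) (inj₂ e) = 1+n≢n (suc-injective e)
consecutive-no-triangle (inj₂ refl) (inj₁ refl) (inj₁ e) = 1+n≢n (suc-injective e)
consecutive-no-triangle (inj₂ refl) (inj₁ refl) (inj₂ ())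

consecutive-+ : ∀ p {a b} → Consecutive a b → Consecutive (p + a) (p + b)
consecutive-+ p (inj₁ refl) = inj₁ (+-suc p _)
consecutive-+ p (inj₂ refl) = inj₂ (+-suc p _)

consecutive-+⁻ : ∀ p {a b} → Consecutive (p + a) (p + b) → Consecutive a b
consecutive-+⁻ p {a} {b} (inj₁ e) = inj₁ (+-cancelˡ-≡ p _ _ (trans e (sym (+-suc p b))))
consecutive-+⁻ p {a} {b} (inj₂ e) = inj₂ (+-cancelˡ-≡ p _ _ (trans e (sym (+-suc p a))))

-- A last step against the direction so far would return to the value two steps earlier, which the
-- second hypothesis excludes.
walk-straight : ∀ n (g : ℕ → ℕ) → (∀ k → k < n → Consecutive (g k) (g (suc k))) →
                (∀ k → suc (suc k) ≤ n → g k ≢ g (suc (suc k))) →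
                (∀ k → k ≤ n → g k ≡ g 0 + k) ⊎ (∀ k → k ≤ n → g k + k ≡ g 0)
walk-straight zero g step turn = inj₁ λ { zero _ → sym (+-identityʳ (g 0)) }
walk-straight (suc n) g step turn
  with walk-straight n g (λ k k<n → step k (m≤n⇒m≤1+n k<n)) (λ k k≤n → turn k (m≤n⇒m≤1+n k≤n)) | step n ≤-refl
... | inj₁ up | inj₂ e = inj₁ λ k k≤ → [ (λ k<sn → up k (≤-pred k<sn))
                                      , (λ { refl → trans e (trans (cong suc (up n ≤-refl)) (sym (+-suc (g 0) n))) }) ]′ (m≤n⇒m<n∨m≡n k≤)
... | inj₂ dn | inj₁ e = inj₂ λ k k≤ → [ (λ k<sn → dn k (≤-pred k<sn))
                                      , (λ { refl → trans (+-suc (g (suc n)) n) (trans (cong (_+ n) (sym e)) (dn n ≤-refl)) }) ]′ (m≤n⇒m<n∨m≡n k≤)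
-- A walk without steps counts as ascending, so the first step may still go down.
walk-straight (suc zero) g step turn | inj₁ up | inj₁ e = inj₂ λ
  { zero _ → +-identityʳ (g 0) ; (suc zero) _ → trans (+-comm (g 1) 1) (sym e) ; (suc (suc k)) (s≤s ()) }
walk-straight (suc (suc n)) g step turn | inj₁ up | inj₁ e =
  ⊥-elim (turn n ≤-refl (suc-injective (trans (cong suc (up n (n≤1+n n))) (trans (sym (+-suc (g 0) n)) (trans (sym (up (suc n) ≤-refl)) e)))))
walk-straight (suc zero) g step turn | inj₂ dn | inj₂ e = inj₁ λ
  { zero _ → sym (+-identityʳ (g 0)) ; (suc zero) _ → trans e (+-comm 1 (g 0)) ; (suc (suc k)) (s≤s ()) }
walk-straight (suc (suc n)) g step turn | inj₂ dn | inj₂ e =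
  ⊥-elim (turn n ≤-refl (+-cancelʳ-≡ n _ _ (trans (dn n (n≤1+n n)) (trans (sym (dn (suc n) ≤-refl)) (trans (+-suc (g (suc n)) n) (cong (_+ n) (sym e)))))))

_⊙_ : ∀ {G H K} → Embeds H K → Embeds G H → Embeds G K
e ⊙ d = record
  { f     = e.f ∘ d.f
  ; inj   = λ x y h → d.inj x y (e.inj _ _ h)
  ; pres  = λ x y h → e.pres _ _ (d.pres x y h)
  ; refl' = λ x y h → d.refl' x y (e.refl' _ _ h) }
  where
  module e = Embedding e
  module d = Embedding d

idEmbedding : ∀ G → Embeds G G
idEmbedding G = record { f = id ; inj = λ _ _ → id ; pres = λ _ _ → id ; refl' = λ _ _ → id }

forget-Induced : ∀ G S → IsPropPred S → Embeds (Induced G S) G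
forget-Induced G S prop = record
  { f = proj₁ ; inj = λ { (x , p) (.x , q) refl → cong (x ,_) (prop x p q) }
  ; pres = λ _ _ → id ; refl' = λ _ _ → id }

-- Indices above `m` are sent to `m`. Path vertices can then be indexed by arithmetic in `ℕ`, with
-- bounds demanded only where adjacency is read off.
clamp : ∀ m → ℕ → Fin (suc m)
clamp m k = fromℕ< (s≤s (m⊓n≤n k m))

toℕ-clamp : ∀ {m k} → k ≤ m → toℕᶠ (clamp m k) ≡ k
toℕ-clamp {m} {k} k≤m = trans (toℕ-fromℕ< (s≤s (m⊓n≤n k m))) (m≤n⇒m⊓n≡m k≤m)

module _ {G : Graph} {m : ℕ} (e : Embeds (PathGraph m) G) where

  open Embedding e

  vertex : ℕ → V G
  vertex k = f (clamp m k)

  vertex-adj : ∀ {k l} → k ≤ m → l ≤ m → Consecutive k l → E G (vertex k) (vertex l)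
  vertex-adj k≤ l≤ c = pres _ _ (subst₂ Consecutive (sym (toℕ-clamp k≤)) (sym (toℕ-clamp l≤)) c)

  vertex-nonadj : ∀ {k l} → k ≤ m → l ≤ m → ¬ Consecutive k l → ¬ E G (vertex k) (vertex l)
  vertex-nonadj k≤ l≤ ¬c h = ¬c (subst₂ Consecutive (toℕ-clamp k≤) (toℕ-clamp l≤) (refl' _ _ h))

  vertex-injective : ∀ {k l} → k ≤ m → l ≤ m → vertex k ≡ vertex l → k ≡ l
  vertex-injective k≤ l≤ h = trans (sym (toℕ-clamp k≤)) (trans (cong toℕᶠ (inj _ _ h)) (toℕ-clamp l≤))

data Adj (w : Seq) (i a j b : ℕ) : Set where
  up   : i < j → w b ≡ true → Adj w i a j b
  down : j < i → w a ≡ true → Adj w i a j b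
  side : i ≡ j → Consecutive a b → Adj w i a j b

Layered : Seq → Graph
Layered w = record
  { V    = Σ ℕ Fin
  ; E    = λ x y → Adj w (proj₁ x) (toℕᶠ (proj₂ x)) (proj₁ y) (toℕᶠ (proj₂ y))
  ; symE = λ { _ _ (up h e) → down h e ; _ _ (down h e) → up h e ; _ _ (side h e) → side (sym h) (swap e) }
  ; irrE = λ { _ (up h _) → <-irrefl refl h ; _ (down h _) → <-irrefl refl h ; _ (side _ c) → consecutive-irreflexive c } }

level : Σ ℕ Fin → ℕ
level = proj₁

pos : Σ ℕ Fin → ℕ
pos x = toℕᶠ (proj₂ x)

pos<level : ∀ x → pos x < level x
pos<level x = toℕ<n (proj₂ x)

level-pos-injective : ∀ {x y} → level x ≡ level y → pos x ≡ pos y → x ≡ y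
level-pos-injective {i , _} {.i , _} refl e = cong (i ,_) (toℕᶠ-injective e)

levelPath : ∀ w m L → suc m ≤ L → Embeds (PathGraph m) (Layered w)
levelPath w m L h = record
  { f     = λ k → L , inject≤ k h
  ; inj   = λ k l e → toℕᶠ-injective (trans (sym (toℕ-inject≤ k h)) (trans (cong pos e) (toℕ-inject≤ l h)))
  ; pres  = λ k l c → side refl (subst₂ Consecutive (sym (toℕ-inject≤ k h)) (sym (toℕ-inject≤ l h)) c)
  ; refl' = λ { k l (up h< _) → ⊥-elim (<-irrefl refl h<) ; k l (down h< _) → ⊥-elim (<-irrefl refl h<)
              ; k l (side _ c) → subst₂ Consecutive (toℕ-inject≤ k h) (toℕ-inject≤ l h) c } }

module _ {w : Seq} {m : ℕ} (e : Embeds (PathGraph m) (Layered w)) where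

  private
    v : ℕ → Σ ℕ Fin
    v = vertex e

  record Jump (k : ℕ) : Set where
    field
      top bottom : ℕ
      bottom≤    : bottom ≤ m
      top-near   : top ≡ k ⊎ top ≡ suc k
      bot-near   : bottom ≡ k ⊎ bottom ≡ suc k
      drop       : level (v bottom) < level (v top)
      top-low    : ∀ z → z ≤ m → ¬ Consecutive z top → level (v top) ≤ level (v z)

  -- The upper end of an edge between levels has label `true`, hence is adjacent to everything
  -- lower. In an induced path only its path neighbours can therefore be lower.
  jump : ∀ k → suc k ≤ m → level (v k) ≢ level (v (suc k)) → Jump k
  jump k k<m ne with vertex-adj e (<⇒≤ k<m) k<m (inj₂ refl)
  ... | side h _ = ⊥-elim (ne h)
  ... | up h lab = record
    { top = suc k ; bottom = k ; bottom≤ = <⇒≤ k<m ; top-near = inj₂ refl ; bot-near = inj₁ refl ; drop = h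
    ; top-low = λ z z≤m nc → ≮⇒≥ λ z< → vertex-nonadj e z≤m k<m nc (up z< lab) }
  ... | down h lab = record
    { top = k ; bottom = suc k ; bottom≤ = k<m ; top-near = inj₁ refl ; bot-near = inj₂ refl ; drop = h
    ; top-low = λ z z≤m nc → ≮⇒≥ λ z< → vertex-nonadj e z≤m (<⇒≤ k<m) nc (up z< lab) }

  Flat : ℕ → ℕ → Set
  Flat o n = ∀ k → k ≤ n → level (v (o + k)) ≡ level (v o)

  flat? : ∀ o n → Flat o n ⊎ ∃[ k ] (k < n × level (v (o + k)) ≢ level (v (suc (o + k))))
  flat? o n with anyUpTo? (λ k → ¬? (level (v (o + k)) ≟ⁿ level (v (suc (o + k))))) n
  ... | yes j = inj₂ j
  ... | no ¬j = inj₁ flat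
    where
    flat : Flat o n
    flat zero    _   = cong (level ∘ v) (+-identityʳ o)
    flat (suc k) k<n = trans (cong (level ∘ v) (+-suc o k)) (trans
      (sym (decidable-stable (_ ≟ⁿ _) (λ ne → ¬j (k , k<n , ne)))) (flat k (<⇒≤ k<n)))
  
  -- Each of two distant jumps would have its lower end at least as high as the upper end of the other.
  no-distant-jumps : ∀ {k l} → suc (suc k) < l → Jump k → ¬ Jump l
  no-distant-jumps {k} {l} k+2<l r s = <-irrefl refl (begin-strict
    level (v r.bottom) <⟨ r.drop ⟩
    level (v r.top)    ≤⟨ r.top-low s.bottom s.bottom≤ (far r.top-near s.bot-near ∘ swap) ⟩
    level (v s.bottom) <⟨ s.drop ⟩
    level (v s.top)    ≤⟨ s.top-low r.bottom r.bottom≤ (far r.bot-near s.top-near) ⟩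
    level (v r.bottom) ∎)
    where
    open ≤-Reasoning
    module r = Jump r
    module s = Jump s
    below : ∀ {a} → a ≡ k ⊎ a ≡ suc k → a ≤ suc k
    below (inj₁ refl) = n≤1+n k
    below (inj₂ refl) = ≤-refl
    above : ∀ {b} → b ≡ l ⊎ b ≡ suc l → l ≤ b
    above (inj₁ refl) = ≤-refl
    above (inj₂ refl) = n≤1+n l
    far : ∀ {a b} → a ≡ k ⊎ a ≡ suc k → b ≡ l ⊎ b ≡ suc l → ¬ Consecutive a b
    far {a} {b} p q c = excluded c
      where
      gap : suc a < b
      gap = ≤-trans (s≤s (s≤s (below p))) (≤-trans k+2<l (above q))
      excluded : ¬ Consecutive a b
      excluded (inj₁ refl) = <-asym gap (s≤s (n≤1+n b))
      excluded (inj₂ refl) = <-irrefl refl gap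

  record Segment (n : ℕ) : Set where
    field
      start height base : ℕ
      fits     : start + n ≤ m
      flat     : ∀ k → k ≤ n → level (v (start + k)) ≡ height
      straight : (∀ k → k ≤ n → pos (v (start + k)) ≡ base + k) ⊎ (∀ k → k ≤ n → pos (v (start + k)) + k ≡ base)

    inside : ∀ k → k ≤ n → start + k ≤ m
    inside k k≤n = ≤-trans (+-monoʳ-≤ start k≤n) fits

    interval : ∃[ P ] (∀ a → a ≤ n → ∃[ k ] (level (v k) ≡ height × pos (v k) ≡ P + a))
    interval with straight
    ... | inj₁ forward  = base , λ a a≤n → start + a , flat a a≤n , forward a a≤n
    -- A descending segment is read from its last vertex, which has the lowest position.
    ... | inj₂ backward = pos (v (start + n)) , λ a a≤n →
      start + (n ∸ a) , flat (n ∸ a) (m∸n≤m n a) , +-cancelʳ-≡ (n ∸ a) _ _ (begin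
        pos (v (start + (n ∸ a))) + (n ∸ a) ≡⟨ backward (n ∸ a) (m∸n≤m n a) ⟩
        base                                ≡⟨ backward n ≤-refl ⟨
        pos (v (start + n)) + n             ≡⟨ cong (pos (v (start + n)) +_) (m+[n∸m]≡n a≤n) ⟨
        pos (v (start + n)) + (a + (n ∸ a)) ≡⟨ +-assoc _ a (n ∸ a) ⟨
        pos (v (start + n)) + a + (n ∸ a)   ∎)
      where open ≡-Reasoning

    -- Level `i` has only `i` vertices, so long segments lie high. This places copies on ever higher
    -- levels and provides vertices outside a bounded set of levels.
    n<height : n < height
    n<height with interval
    ... | P , cover with cover n ≤-refl
    ...   | k , lev , at = begin-strict
      n           ≤⟨ m≤n+m n P ⟩
      P + n       ≡⟨ at ⟨
      pos (v k)   <⟨ pos<level (v k) ⟩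
      level (v k) ≡⟨ lev ⟩
      height      ∎
      where open ≤-Reasoning

  -- Within one level adjacency means neighbouring positions, and injectivity of the path forbids
  -- turning back.
  flat⇒segment : ∀ o n → o + n ≤ m → Flat o n → Segment n
  flat⇒segment o n o+n≤m fl = record
    { start = o ; height = level (v o) ; base = pos (v (o + 0)) ; fits = o+n≤m ; flat = fl
    ; straight = walk-straight n (λ k → pos (v (o + k))) step turn }
    where
    inside : ∀ {k} → k ≤ n → o + k ≤ m
    inside k≤n = ≤-trans (+-monoʳ-≤ o k≤n) o+n≤m
    step : ∀ k → k < n → Consecutive (pos (v (o + k))) (pos (v (o + suc k)))
    step k k<n with vertex-adj e (inside (<⇒≤ k<n)) (inside k<n) (consecutive-+ o (inj₂ refl))
    ... | side _ c = c
    ... | up h _   = ⊥-elim (<-irrefl (trans (fl k (<⇒≤ k<n)) (sym (fl (suc k) k<n))) h)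
    ... | down h _ = ⊥-elim (<-irrefl (trans (fl (suc k) k<n) (sym (fl k (<⇒≤ k<n)))) h)
    turn : ∀ k → suc (suc k) ≤ n → pos (v (o + k)) ≢ pos (v (o + suc (suc k)))
    turn k h eq = m≢1+n+m k {1} (+-cancelˡ-≡ o _ _ (vertex-injective e (inside k≤n) (inside h)
      (level-pos-injective (trans (fl k k≤n) (sym (fl (suc (suc k)) h))) eq)))
      where
      k≤n : k ≤ n
      k≤n = ≤-trans (≤-trans (n≤1+n k) (n≤1+n (suc k))) h

  -- The vertices `0` to `n` and `n + 2` to `2n + 2` form two windows. Jumps in both would be more
  -- than two apart, so one window stays on a single level.
  long-segment : ∀ n → suc (suc n) + n ≤ m → Segment n
  long-segment n h with flat? 0 n | flat? (suc (suc n)) n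
  ... | inj₁ fl | _ = flat⇒segment 0 n (≤-trans (m≤n+m n (suc (suc n))) h) fl
  ... | inj₂ _  | inj₁ fl = flat⇒segment (suc (suc n)) n h fl
  ... | inj₂ (k , k<n , ne) | inj₂ (l , l<n , ne′) = ⊥-elim (no-distant-jumps
    (s≤s (s≤s (≤-trans k<n (m≤m+n n l))))
    (jump k (≤-trans k<n (≤-trans (m≤n+m n (suc (suc n))) h)) ne)
    (jump (suc (suc n) + l) (≤-trans (s≤s (s≤s (subst (_≤ n + n) (+-suc n l) (+-monoʳ-≤ n l<n)))) h) ne′))

-- Long paths, and non-primality of all equimorphic graphs.

Layered-HasLongPaths : ∀ w → HasLongPaths (Layered w)
Layered-HasLongPaths w n = n , ≤-refl , levelPath w n (suc n) ≤-refl

-- Seen inside `Layered w`, a vertex of `H` above level `j` is joined to all or none of the vertices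
-- up to `j`, according to its label. The value of `j` is chosen so that `Low` catches two distinct
-- vertices.
Layered-equimorphic-not-prime : ∀ w H → Equimorphic H (Layered w) → ¬ Prime H
Layered-equimorphic-not-prime w H (e , d) (_ , trivial) = nontrivial (trivial Low low-module)
  where
  module e = Embedding e
  module d = Embedding d
  j : ℕ
  j = level (e.f (d.f (1 , zero))) ⊔ level (e.f (d.f (2 , zero)))
  Low : V H → Set
  Low x = level (e.f x) ≤ j
  low-module : IsModule H Low
  low-module x x-high (a , b , a-low , b-low , xa , ¬xb) with e.pres x a xa
  ... | up h _     = x-high (≤-trans (<⇒≤ h) a-low)
  ... | side h _   = x-high (≤-trans (≤-reflexive h) a-low)
  ... | down _ lab = ¬xb (e.refl' x b (down (≤-<-trans b-low (≰⇒> x-high)) lab))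
  nontrivial : ¬ TrivialModule H Low
  nontrivial (inj₁ empty) = empty (d.f (1 , zero)) (m≤m⊔n _ _)
  nontrivial (inj₂ (inj₁ (x , single)))
    with d.inj _ _ (trans (proj₁ (single (d.f (1 , zero))) (m≤m⊔n _ _))
                          (sym (proj₁ (single (d.f (2 , zero))) (m≤n⊔m _ _))))
  ... | ()
  -- A path of length `2j + 2`, sent into `H` and back, contains a segment of length `j`, which lies
  -- above level `j`.
  nontrivial (inj₂ (inj₂ all-low)) =
    <⇒≱ n<height (subst (_≤ j) (flat 0 z≤n) (all-low (d.f (vertex (levelPath w m (suc m) ≤-refl) (start + 0)))))
    where
    m : ℕ
    m = suc (suc j) + j
    open Segment (long-segment ((e ⊙ d) ⊙ levelPath w m (suc m) ≤-refl) j ≤-refl)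

-- Path-minimality from uniform recurrence.

step-mono⇒mono : (h : ℕ → ℕ) → (∀ i → h i < h (suc i)) → ∀ {i j} → i < j → h i < h j
step-mono⇒mono h step {i} {suc j} (s≤s i≤j) with m≤n⇒m<n∨m≡n i≤j
... | inj₁ i<j  = <-trans (step-mono⇒mono h step i<j) (step j)
... | inj₂ refl = step i

mono⇒cancel-< : (h : ℕ → ℕ) → (∀ {i j} → i < j → h i < h j) → ∀ {i j} → h i < h j → i < j
mono⇒cancel-< h mono {i} {j} lt with <-cmp i j
... | tri< i<j _ _  = i<j
... | tri≈ _ refl _ = ⊥-elim (<-irrefl refl lt)
... | tri> _ _ j<i  = ⊥-elim (<-asym lt (mono j<i))

mono⇒injective : (h : ℕ → ℕ) → (∀ {i j} → i < j → h i < h j) → ∀ {i j} → h i ≡ h j → i ≡ j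
mono⇒injective h mono {i} {j} eq with <-cmp i j
... | tri< i<j _ _ = ⊥-elim (<-irrefl eq (mono i<j))
... | tri≈ _ e _   = e
... | tri> _ _ j<i = ⊥-elim (<-irrefl (sym eq) (mono j<i))

UniformlyRecurrent : Seq → Set
UniformlyRecurrent w = ∀ p l → ∃[ B ] (∀ q → ∃[ r ] (r + l ≤ B × (∀ {a} → a < l → w (p + a) ≡ w (q + (r + a)))))

-- The intended image of level `i`: an interval on one level, lying in `S` and labelled by the
-- prefix of `w`. The free `bound` allows successive copies to be placed in increasing order.
record Copy (w : Seq) (S : Σ ℕ Fin → Set) (bound i : ℕ) : Set where
  field
    height base  : ℕ
    bound<height : bound < height
    point    : ∀ a → a < i → Σ (Σ ℕ Fin) S
    on-level : ∀ a (a<i : a < i) → level (proj₁ (point a a<i)) ≡ height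
    at-pos   : ∀ a (a<i : a < i) → pos (proj₁ (point a a<i)) ≡ base + a
    label    : ∀ a → a < i → w a ≡ w (base + a)

-- In the segment length `bound + B`, the first summand forces the level above `bound`, and the
-- second leaves room for an occurrence of the prefix of length `i`.
long-paths⇒copy : ∀ {w} → UniformlyRecurrent w → ∀ S → IsPropPred S →
                  HasLongPaths (Induced (Layered w) S) → ∀ bound i → Copy w S bound i
long-paths⇒copy {w} recurrent S prop long bound i with recurrent 0 i
... | B , occurs with long (suc (suc (bound + B)) + (bound + B))
...   | m , long-enough , path with long-segment (forget-Induced (Layered w) S prop ⊙ path) (bound + B) long-enough
...     | seg with Segment.interval seg
...       | P , cover with occurs P
...         | r , r+i≤B , same = record
  { height = Segment.height seg ; base = P + r
  ; bound<height = ≤-<-trans (m≤m+n bound B) (Segment.n<height seg)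
  ; point    = λ a a<i → Embedding.f path (clamp m (proj₁ (at a a<i)))
  ; on-level = λ a a<i → proj₁ (proj₂ (at a a<i))
  ; at-pos   = λ a a<i → trans (proj₂ (proj₂ (at a a<i))) (sym (+-assoc P r a))
  ; label    = λ a a<i → trans (same a<i) (cong w (sym (+-assoc P r a))) }
  where
  at = λ a (a<i : a < i) → cover (r + a)
    (≤-trans (+-monoʳ-≤ r (<⇒≤ a<i)) (≤-trans r+i≤B (m≤n+m B bound)))

module _ {w : Seq} {S : Σ ℕ Fin → Set} (copy : ∀ bound i → Copy w S bound i) where

  open Copy

  private
    bound : ℕ → ℕ
    bound zero    = 0
    bound (suc i) = height (copy (bound i) i)

    copies : ∀ i → Copy w S (bound i) i
    copies i = copy (bound i) i

    heights : ℕ → ℕ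
    heights i = height (copies i)

    heights-mono : ∀ {i j} → i < j → heights i < heights j
    heights-mono = step-mono⇒mono heights (λ i → bound<height (copies (suc i)))

    image : Σ ℕ Fin → Σ (Σ ℕ Fin) S
    image (i , a) = point (copies i) (toℕᶠ a) (toℕ<n a)

    image-level : ∀ x → level (proj₁ (image x)) ≡ heights (level x)
    image-level (i , a) = on-level (copies i) (toℕᶠ a) (toℕ<n a)

    image-pos : ∀ x → pos (proj₁ (image x)) ≡ base (copies (level x)) + pos x
    image-pos (i , a) = at-pos (copies i) (toℕᶠ a) (toℕ<n a)

    image-label : ∀ x → w (pos x) ≡ w (pos (proj₁ (image x)))
    image-label x = trans (label (copies (level x)) (pos x) (pos<level x)) (cong w (sym (image-pos x)))

    level-cancel : ∀ x y → level (proj₁ (image x)) ≡ level (proj₁ (image y)) → level x ≡ level y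
    level-cancel x y e = mono⇒injective heights heights-mono (trans (sym (image-level x)) (trans e (image-level y)))

  -- Each copy is taken above the preceding one, so the order of levels is kept. Together with the
  -- labels this preserves edges between levels, and translation preserves those within a level.
  copies⇒embedding : Embeds (Layered w) (Induced (Layered w) S)
  copies⇒embedding = record { f = image ; inj = injective ; pres = preserves ; refl' = reflects }
    where
    injective : ∀ x y → image x ≡ image y → x ≡ y
    injective x y e with level-cancel x y (cong (level ∘ proj₁) e)
    ... | refl = level-pos-injective refl (+-cancelˡ-≡ (base (copies (level x))) _ _
                   (trans (sym (image-pos x)) (trans (cong (pos ∘ proj₁) e) (image-pos y))))
    preserves : ∀ x y → E (Layered w) x y → E (Layered w) (proj₁ (image x)) (proj₁ (image y))
    preserves x y (up h e)      = up (subst₂ _<_ (sym (image-level x)) (sym (image-level y)) (heights-mono h)) (trans (sym (image-label y)) e)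
    preserves x y (down h e)    = down (subst₂ _<_ (sym (image-level y)) (sym (image-level x)) (heights-mono h)) (trans (sym (image-label x)) e)
    preserves x y (side refl c) = side (trans (image-level x) (sym (image-level y)))
      (subst₂ Consecutive (sym (image-pos x)) (sym (image-pos y)) (consecutive-+ (base (copies (level x))) c))
    reflects : ∀ x y → E (Layered w) (proj₁ (image x)) (proj₁ (image y)) → E (Layered w) x y
    reflects x y (up h e)   = up (mono⇒cancel-< heights heights-mono (subst₂ _<_ (image-level x) (image-level y) h)) (trans (image-label y) e)
    reflects x y (down h e) = down (mono⇒cancel-< heights heights-mono (subst₂ _<_ (image-level y) (image-level x) h)) (trans (image-label x) e)
    reflects x y (side h c) with level-cancel x y h
    ... | refl = side refl (consecutive-+⁻ (base (copies (level x))) (subst₂ Consecutive (image-pos x) (image-pos y) c))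

Layered-PathMinimal : ∀ {w} → UniformlyRecurrent w → PathMinimal (Layered w)
Layered-PathMinimal {w} recurrent =
  Layered-HasLongPaths w , λ S prop long → copies⇒embedding (long-paths⇒copy recurrent S prop long)

-- Incomparable ages

true-⇔⇒≡ : ∀ {a b} → (a ≡ true → b ≡ true) → (b ≡ true → a ≡ true) → a ≡ b
true-⇔⇒≡ {true}          f g = sym (f refl)
true-⇔⇒≡ {false} {true}  f g = g refl
true-⇔⇒≡ {false} {false} f g = refl

Adj-upward : ∀ {w i a j b} → i < j → Adj w i a j b → w b ≡ true
Adj-upward i<j (up _ e)      = e
Adj-upward i<j (down j<i _)  = ⊥-elim (<-asym i<j j<i)
Adj-upward i<j (side refl _) = ⊥-elim (<-irrefl refl i<j)

Adj-downward : ∀ {w i a j b} → j < i → Adj w i a j b → w a ≡ true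
Adj-downward j<i (up i<j _)    = ⊥-elim (<-asym i<j j<i)
Adj-downward j<i (down _ e)    = e
Adj-downward j<i (side refl _) = ⊥-elim (<-irrefl refl j<i)

Adj-level : ∀ {w i a j b} → i ≡ j → Adj w i a j b → Consecutive a b
Adj-level refl (up h _)   = ⊥-elim (<-irrefl refl h)
Adj-level refl (down h _) = ⊥-elim (<-irrefl refl h)
Adj-level refl (side _ c) = c

-- The test graph: all of level `m + 1` below the first `m + 1` vertices of level `m + 2`, so that
-- two equally long paths lie on distinct levels.
module TwoLevels (w : Seq) (m : ℕ) where

  private
    low high : Embeds (PathGraph m) (Layered w)
    low  = levelPath w m (suc m) ≤-refl
    high = levelPath w m (suc (suc m)) (n≤1+n (suc m))

    place⊎ : Fin (suc m) ⊎ Fin (suc m) → Σ ℕ Fin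
    place⊎ = [ Embedding.f low , Embedding.f high ]′

    place⊎-injective : ∀ s t → place⊎ s ≡ place⊎ t → s ≡ t
    place⊎-injective (inj₁ a) (inj₁ b) e = cong inj₁ (Embedding.inj low a b e)
    place⊎-injective (inj₂ a) (inj₂ b) e = cong inj₂ (Embedding.inj high a b e)
    place⊎-injective (inj₁ a) (inj₂ b) e = ⊥-elim (1+n≢n (sym (cong level e)))
    place⊎-injective (inj₂ a) (inj₁ b) e = ⊥-elim (1+n≢n (cong level e))

    place : Fin (suc m + suc m) → Σ ℕ Fin
    place k = place⊎ (splitAt (suc m) k)

    place-injective : ∀ k l → place k ≡ place l → k ≡ l
    place-injective k l e = trans (sym (join-splitAt (suc m) (suc m) k))
      (trans (cong (join (suc m) (suc m)) (place⊎-injective (splitAt (suc m) k) (splitAt (suc m) l) e))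
             (join-splitAt (suc m) (suc m) l))

  graph : FinGraph
  graph = record
    { n = suc m + suc m ; Ef = λ k l → E (Layered w) (place k) (place l)
    ; symEf = λ k l → symE (Layered w) (place k) (place l) ; irrEf = λ k → irrE (Layered w) (place k) }

  inAge : InAge (Layered w) graph
  inAge = record { f = place ; inj = place-injective ; pres = λ _ _ → id ; refl' = λ _ _ → id }

  private
    lift : (d : Embeds (PathGraph m) (Layered w)) (h : Fin (suc m) → Fin (suc m + suc m)) →
           (∀ x → place (h x) ≡ Embedding.f d x) → Embeds (PathGraph m) (toGraph graph)
    lift d h eq = record
      { f = h ; inj = λ x y e → d.inj x y (trans (sym (eq x)) (trans (cong place e) (eq y)))
      ; pres  = λ x y e → subst₂ (E (Layered w)) (sym (eq x)) (sym (eq y)) (d.pres x y e)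
      ; refl' = λ x y e → d.refl' x y (subst₂ (E (Layered w)) (eq x) (eq y) e) }
      where module d = Embedding d

    place-low : ∀ a → place (a ↑ˡ suc m) ≡ Embedding.f low a
    place-low a = cong place⊎ (splitAt-↑ˡ (suc m) a (suc m))

    place-high : ∀ b → place (suc m ↑ʳ b) ≡ Embedding.f high b
    place-high b = cong place⊎ (splitAt-↑ʳ (suc m) (suc m) b)

  lowPath highPath : Embeds (PathGraph m) (toGraph graph)
  lowPath  = lift low (_↑ˡ suc m) place-low
  highPath = lift high (suc m ↑ʳ_) place-high

  high-label : ∀ {l} → l ≤ m → pos (Embedding.f high (clamp m l)) ≡ l
  high-label {l} l≤m = trans (toℕ-inject≤ (clamp m l) (n≤1+n (suc m))) (toℕ-clamp l≤m)

  cross⁺ : ∀ k {l} → l ≤ m → w l ≡ true → E (toGraph graph) (vertex lowPath k) (vertex highPath l)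
  cross⁺ k {l} l≤m e = subst₂ (E (Layered w)) (sym (place-low (clamp m k))) (sym (place-high (clamp m l)))
    (up ≤-refl (trans (cong w (high-label l≤m)) e))

  cross⁻ : ∀ k {l} → l ≤ m → E (toGraph graph) (vertex lowPath k) (vertex highPath l) → w l ≡ true
  cross⁻ k {l} l≤m h = trans (cong w (sym (high-label l≤m)))
    (Adj-upward ≤-refl (subst₂ (E (Layered w)) (place-low (clamp m k)) (place-high (clamp m l)) h))

-- A long path of the graph lies above another one, and its labels are visible as its
-- adjacencies to the lower path. So an embedding into Layered w′ makes them spell a
-- factor of w′, forwards or backwards.
module _ {w w′ : Seq} (n : ℕ) (hits-true : ∀ o → ∃[ i ] (i ≤ suc n × w (o + i) ≡ true))
         (non-constant : ∀ o b → ¬ (∀ i → i ≤ suc n → w (o + i) ≡ b)) where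

  -- The length at which `long-segment` yields segments of length `suc n`, so that vertices `0` and
  -- `1` of the lower segment exist.
  open TwoLevels w (suc (suc (suc n)) + suc n)

  age⇒factor : InAge (Layered w′) graph → ∃[ o ] ∃[ P ]
    ((∀ i → i ≤ suc n → w (o + i) ≡ w′ (P + i)) ⊎ (∀ i → i ≤ suc n → ∃[ x ] (x + i ≡ P × w (o + i) ≡ w′ x)))
  age⇒factor e with long-segment (e ⊙ lowPath) (suc n) ≤-refl | long-segment (e ⊙ highPath) (suc n) ≤-refl
  ... | low | high = compare (<-cmp low.height high.height)
    where
    module e = Embedding e
    module low = Segment low
    module high = Segment high
    x y : ℕ → Σ ℕ Fin
    x k = e.f (vertex lowPath (low.start + k))
    y l = e.f (vertex highPath (high.start + l))
    joined : ∀ k l → l ≤ suc n → w (high.start + l) ≡ true → E (Layered w′) (x k) (y l)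
    joined k l l≤ h = e.pres _ _ (cross⁺ (low.start + k) (high.inside l l≤) h)
    joined⁻ : ∀ k l → l ≤ suc n → E (Layered w′) (x k) (y l) → w (high.start + l) ≡ true
    joined⁻ k l l≤ h = cross⁻ (low.start + k) (high.inside l l≤) (e.refl' _ _ h)
    level-x : ∀ k → k ≤ suc n → level (x k) ≡ low.height
    level-x = low.flat
    level-y : ∀ l → l ≤ suc n → level (y l) ≡ high.height
    level-y = high.flat
    compare : _ → _
    compare (tri< lt _ _) = high.start , high.base , orient high.straight
      where
      x₀<y : ∀ l → l ≤ suc n → level (x 0) < level (y l)
      x₀<y l l≤ = subst₂ _<_ (sym (level-x 0 z≤n)) (sym (level-y l l≤)) lt
      same : ∀ l → l ≤ suc n → w (high.start + l) ≡ w′ (pos (y l))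
      same l l≤ = true-⇔⇒≡ (λ h → Adj-upward (x₀<y l l≤) (joined 0 l l≤ h))
                           (λ h → joined⁻ 0 l l≤ (up (x₀<y l l≤) h))
      orient : _ → _
      orient (inj₁ forward)  = inj₁ λ l l≤ → trans (same l l≤) (cong w′ (forward l l≤))
      orient (inj₂ backward) = inj₂ λ l l≤ → pos (y l) , backward l l≤ , same l l≤
    -- On a common level, an upper vertex labelled `true` and the first two vertices of the lower
    -- segment would form a triangle of consecutive positions.
    compare (tri≈ _ eq _) with hits-true high.start
    ... | l , l≤ , h = ⊥-elim (consecutive-no-triangle
      (swap (Adj-level (x≡y 0 z≤n) (joined 0 l l≤ h)))
      (swap (Adj-level (x≡y 1 (s≤s z≤n)) (joined 1 l l≤ h)))
      (Adj-level (trans (level-x 0 z≤n) (sym (level-x 1 (s≤s z≤n))))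
        (e.pres _ _ (vertex-adj lowPath (low.inside 0 z≤n) (low.inside 1 (s≤s z≤n)) (consecutive-+ low.start (inj₂ refl))))))
      where
      x≡y : ∀ k → k ≤ suc n → level (x k) ≡ level (y l)
      x≡y k k≤ = trans (level-x k k≤) (trans eq (sym (level-y l l≤)))
    -- With the levels swapped, the label of `x 0` alone would decide its adjacency to every `y l`,
    -- making the labels constant.
    compare (tri> _ _ gt) = ⊥-elim (non-constant high.start (w′ (pos (x 0))) λ l l≤ →
      true-⇔⇒≡ (λ h → Adj-downward (y<x₀ l l≤) (joined 0 l l≤ h))
               (λ h → joined⁻ 0 l l≤ (down (y<x₀ l l≤) h)))
      where
      y<x₀ : ∀ l → l ≤ suc n → level (y l) < level (x 0)
      y<x₀ l l≤ = subst₂ _<_ (sym (level-y l l≤)) (sym (level-x 0 z≤n)) gt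


age-distinguishes : ∀ {c d} → NoTripleRepeat c → NoTripleRepeat d → ∀ k → c k ≢ d k →
                    ¬ AgeSubset (Layered (toeplitz c)) (Layered (toeplitz d))
age-distinguishes {c} {d} ntc ntd k ck≢dk subset = ck≢dk (matched (age⇒factor n hits-true non-constant
  (subset (TwoLevels.graph (toeplitz c) (suc (suc (suc n)) + suc n)) (TwoLevels.inAge (toeplitz c) (suc (suc (suc n)) + suc n)))))
  where
  n : ℕ
  n = 2 ^ (4 + k)
  8≤n : 8 ≤ n
  8≤n = ^-monoʳ-≤ 2 (m≤m+n 3 (suc k))
  hits-true : ∀ o → ∃[ i ] (i ≤ suc n × toeplitz c (o + i) ≡ true)
  hits-true o with toeplitz-hits-true ntc o
  ... | i , i<8 , e = i , ≤-trans (<⇒≤ i<8) (m≤n⇒m≤1+n 8≤n) , e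
  non-constant : ∀ o b → ¬ (∀ i → i ≤ suc n → toeplitz c (o + i) ≡ b)
  non-constant o b const = toeplitz-not-constant ntc o b λ i i<8 → const i (≤-trans (<⇒≤ i<8) (m≤n⇒m≤1+n 8≤n))
  matched : ∃[ o ] ∃[ P ]
    ((∀ i → i ≤ suc n → toeplitz c (o + i) ≡ toeplitz d (P + i)) ⊎
     (∀ i → i ≤ suc n → ∃[ x ] (x + i ≡ P × toeplitz c (o + i) ≡ toeplitz d x))) → c k ≡ d k
  matched (o , P , inj₁ forward) = toeplitz-match k ntc ntd o P λ i i<n → forward i (m≤n⇒m≤1+n (<⇒≤ i<n))
  matched (o , P , inj₂ backward) = toeplitz-match k ntc ntd o P′ λ i i<n →
    reflect i (backward i (m≤n⇒m≤1+n (<⇒≤ i<n)))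
    where
    K P′ : ℕ
    -- The mirror image of `x = P - i` is `2 ^ K - 2 - x = P′ + i`, so the mirrored factor runs
    -- forwards. This `K` ensures `suc (suc P) < 2 ^ K`.
    K = suc (suc P)
    P′ = 2 ^ K ∸ suc (suc P)
    reflect : ∀ i → ∃[ x ] (x + i ≡ P × toeplitz c (o + i) ≡ toeplitz d x) → toeplitz c (o + i) ≡ toeplitz d (P′ + i)
    reflect i (x , x+i≡P , e) = trans e (toeplitz-mirror K d x (P′ + i) (begin
      suc x + suc (P′ + i)      ≡⟨ lemma x P′ i ⟩
      P′ + suc (suc (x + i))    ≡⟨ cong (λ z → P′ + suc (suc z)) x+i≡P ⟩
      P′ + suc (suc P)          ≡⟨ m∸n+n≡m (<⇒≤ (n<2^n K)) ⟩
      2 ^ K                     ∎))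
      where
      open ≡-Reasoning
      lemma : ∀ x p i → suc x + suc (p + i) ≡ p + suc (suc (x + i))
      lemma = solve-∀

-- Well-quasi-ordered ages

image-⊆⇒embeds : ∀ {A B G} (e : Embeds A G) (d : Embeds B G) →
                 (∀ a → ∃[ b ] Embedding.f d b ≡ Embedding.f e a) → Embeds A B
image-⊆⇒embeds {A} {B} {G} e d onto = record
  { f = proj₁ ∘ onto
  ; inj = λ x y h → e.inj x y (trans (sym (proj₂ (onto x))) (trans (cong d.f h) (proj₂ (onto y))))
  ; pres = λ x y h → d.refl' _ _ (subst₂ (E G) (sym (proj₂ (onto x))) (sym (proj₂ (onto y))) (e.pres x y h))
  ; refl' = λ x y h → e.refl' _ _ (subst₂ (E G) (proj₂ (onto x)) (proj₂ (onto y)) (d.pres _ _ h)) }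
  where
  module e = Embedding e
  module d = Embedding d

-- Labelled graphs and their sums.

record Labelled : Set₁ where
  field
    graph : Graph
    label : V graph → Bool
open Labelled

record _↪_ (A B : Labelled) : Set where
  field
    embeds : Embeds (graph A) (graph B)
  open Embedding embeds public
  field
    labels : ∀ x → label B (f x) ≡ label A x
open _↪_ using (embeds)

infixr 9 _∘↪_
_∘↪_ : ∀ {A B C} → B ↪ C → A ↪ B → A ↪ C
e ∘↪ d = record { embeds = embeds e ⊙ embeds d
                ; labels = λ x → trans (_↪_.labels e _) (_↪_.labels d x) }

empty : Labelled
empty = record { graph = record { V = ⊥ ; E = λ () ; symE = λ () ; irrE = λ () } ; label = λ () }

from-empty : ∀ {A} → empty ↪ A
from-empty = record { embeds = record { f = λ () ; inj = λ () ; pres = λ () ; refl' = λ () } ; labels = λ () }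

module _ (cross : Bool → Set) where

  -- Edges across the sum depend on the label of the left vertex only. Constant `⊥` gives the
  -- disjoint union of the intervals in one level; `_≡ true` stacks the left summand on top of the
  -- right one.
  ⊕-E : ∀ A B → V (graph A) ⊎ V (graph B) → V (graph A) ⊎ V (graph B) → Set
  ⊕-E A B (inj₁ x) (inj₁ y) = E (graph A) x y
  ⊕-E A B (inj₁ x) (inj₂ _) = cross (label A x)
  ⊕-E A B (inj₂ _) (inj₁ y) = cross (label A y)
  ⊕-E A B (inj₂ x) (inj₂ y) = E (graph B) x y

  ⊕ : Labelled → Labelled → Labelled
  ⊕ A B = record
    { graph = record
      { V = V (graph A) ⊎ V (graph B)
      ; E = ⊕-E A B
      ; symE = λ { (inj₁ x) (inj₁ y) → symE (graph A) x y ; (inj₁ _) (inj₂ _) → id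
                 ; (inj₂ _) (inj₁ _) → id ; (inj₂ x) (inj₂ y) → symE (graph B) x y }
      ; irrE = λ { (inj₁ x) → irrE (graph A) x ; (inj₂ x) → irrE (graph B) x } }
    ; label = [ label A , label B ]′ }

  ⊕-join : ∀ {A B C} (e : A ↪ C) (d : B ↪ C) →
           (∀ x y → _↪_.f e x ≢ _↪_.f d y) →
           (∀ x y → cross (label A x) → E (graph C) (_↪_.f e x) (_↪_.f d y)) →
           (∀ x y → E (graph C) (_↪_.f e x) (_↪_.f d y) → cross (label A x)) →
           ⊕ A B ↪ C
  ⊕-join {A} {B} {C} e d apart to from = record
    { embeds = record
      { f = [ e.f , d.f ]′
      ; inj = λ { (inj₁ x) (inj₁ y) h → cong inj₁ (e.inj x y h) ; (inj₁ x) (inj₂ y) h → ⊥-elim (apart x y h)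
                ; (inj₂ x) (inj₁ y) h → ⊥-elim (apart y x (sym h)) ; (inj₂ x) (inj₂ y) h → cong inj₂ (d.inj x y h) }
      ; pres = λ { (inj₁ x) (inj₁ y) → e.pres x y ; (inj₁ x) (inj₂ y) → to x y
                 ; (inj₂ x) (inj₁ y) h → symE (graph C) _ _ (to y x h) ; (inj₂ x) (inj₂ y) → d.pres x y }
      ; refl' = λ { (inj₁ x) (inj₁ y) → e.refl' x y ; (inj₁ x) (inj₂ y) → from x y
                  ; (inj₂ x) (inj₁ y) h → from y x (symE (graph C) _ _ h) ; (inj₂ x) (inj₂ y) → d.refl' x y } }
    ; labels = λ { (inj₁ x) → e.labels x ; (inj₂ x) → d.labels x } }
    where
    module e = _↪_ e
    module d = _↪_ d

  ⊕-inj₁ : ∀ {A B} → A ↪ ⊕ A B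
  ⊕-inj₁ = record { embeds = record { f = inj₁ ; inj = λ { _ _ refl → refl } ; pres = λ _ _ → id ; refl' = λ _ _ → id }
                  ; labels = λ _ → refl }

  ⊕-inj₂ : ∀ {A B} → B ↪ ⊕ A B
  ⊕-inj₂ = record { embeds = record { f = inj₂ ; inj = λ { _ _ refl → refl } ; pres = λ _ _ → id ; refl' = λ _ _ → id }
                  ; labels = λ _ → refl }

  ⊕-mono : ∀ {A A′ B B′} → A ↪ A′ → B ↪ B′ → ⊕ A B ↪ ⊕ A′ B′
  ⊕-mono {A} {A′} {B} {B′} e d = ⊕-join (⊕-inj₁ {A′} {B′} ∘↪ e) (⊕-inj₂ {A′} {B′} ∘↪ d) (λ _ _ ())
    (λ x _ → subst cross (sym (_↪_.labels e x))) (λ x _ → subst cross (_↪_.labels e x))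

  module _ {X : Set} (γ : X → Labelled) where

    ⨁ : List X → Labelled
    ⨁ = foldr (⊕ ∘ γ) empty

    ⨁-mono : ∀ {R : Relation X} → (∀ {x y} → R x y → γ x ↪ γ y) →
             ∀ {xs ys} → Sublist R xs ys → ⨁ xs ↪ ⨁ ys
    ⨁-mono h []                 = from-empty
    ⨁-mono h (_∷ʳ_ {ys = ys} y s) = ⊕-inj₂ {γ y} {⨁ ys} ∘↪ ⨁-mono h s
    ⨁-mono h (r ∷ s)            = ⊕-mono (h r) (⨁-mono h s)

-- Coding finite induced subgraphs by lists of lists of factors.

module _ (w : Seq) where

  LineGraph : Labelled
  LineGraph = record
    { graph = record { V = ℕ ; E = Consecutive ; symE = λ _ _ → swap ; irrE = λ _ → consecutive-irreflexive }
    ; label = w }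

  LayeredGraph : Labelled
  LayeredGraph = record { graph = Layered w ; label = w ∘ pos }

  -- (p , l) stands for the factor of w of length l at position p.
  Factor : Set
  Factor = ℕ × ℕ

  factor : Factor → Labelled
  factor (p , l) = record
    { graph = record { V = Fin l ; E = λ a b → Consecutive (toℕᶠ a) (toℕᶠ b)
                     ; symE = λ _ _ → swap ; irrE = λ _ → consecutive-irreflexive }
    ; label = λ a → w (p + toℕᶠ a) }

  -- The explicit bound on `r` lets the relation be decided by bounded search, as `Higman` requires.
  _≼_ : Relation Factor
  (p , l) ≼ (q , m) = ∃ λ r → r < suc m × (r + l ≤ m × (∀ {a} → a < l → w (p + a) ≡ w (q + (r + a))))

  _≼?_ : Decidable _≼_
  (p , l) ≼? (q , m) = anyUpTo?
    (λ r → (r + l ≤? m) ×-dec allUpTo? (λ a → w (p + a) ≟ w (q + (r + a))) l) (suc m)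

  ≼⇒↪ : ∀ {x y} → x ≼ y → factor x ↪ factor y
  ≼⇒↪ {p , l} {q , m} (r , _ , r+l≤m , same) = record
    { embeds = record
      { f     = shift
      ; inj   = λ a b e → toℕᶠ-injective (+-cancelˡ-≡ r _ _ (trans (sym (toℕ-shift a)) (trans (cong toℕᶠ e) (toℕ-shift b))))
      ; pres  = λ a b c → subst₂ Consecutive (sym (toℕ-shift a)) (sym (toℕ-shift b)) (consecutive-+ r c)
      ; refl' = λ a b c → consecutive-+⁻ r (subst₂ Consecutive (toℕ-shift a) (toℕ-shift b) c) }
    ; labels = λ a → trans (cong (w ∘ (q +_)) (toℕ-shift a)) (sym (same (toℕ<n a))) }
    where
    bound : ∀ a → r + toℕᶠ {l} a < m
    bound a = <-≤-trans (+-monoʳ-< r (toℕ<n a)) r+l≤m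
    shift : Fin l → Fin m
    shift a = fromℕ< (bound a)
    toℕ-shift : ∀ a → toℕᶠ (shift a) ≡ r + toℕᶠ a
    toℕ-shift a = toℕ-fromℕ< (bound a)

  -- Agreement on `M` letters is built up one letter at a time by intersecting with `AF-Bool`. The
  -- letters are read from `w` even past the end of a short factor, which avoids a case split on
  -- lengths.
  AF-prefix : ∀ M → AF (λ (x y : Factor) → proj₂ x ≤ proj₂ y × (∀ {i} → i < M → w (proj₁ x + i) ≡ w (proj₁ y + i)))
  AF-prefix zero    = AF-map proj₂ (λ _ _ h → h , λ ()) AF-≤
  AF-prefix (suc M) = AF-⇒ extend (AF-∩ (AF-prefix M) (AF-map (λ x → w (proj₁ x + M)) (λ _ _ e → e) AF-Bool))
    where
    extend : ∀ (x y : Factor) →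
      (proj₂ x ≤ proj₂ y × (∀ {i} → i < M → w (proj₁ x + i) ≡ w (proj₁ y + i))) × w (proj₁ x + M) ≡ w (proj₁ y + M) →
      proj₂ x ≤ proj₂ y × (∀ {i} → i < suc M → w (proj₁ x + i) ≡ w (proj₁ y + i))
    extend x y ((l≤ , same) , e) = l≤ , λ {i} i<sM → [ same , (λ { refl → e }) ]′ (m≤n⇒m<n∨m≡n (≤-pred i<sM))

  -- By recurrence a factor is contained in all sufficiently long ones, and the others
  -- are words of bounded length.
  AF-factor : UniformlyRecurrent w → AF _≼_
  AF-factor recurrent = later residue
    where
    residue : ∀ z → AF (λ x y → x ≼ y ⊎ z ≼ x)
    residue z@(p , l) with recurrent p l
    ... | B , occurs = AF-⇒ decide (AF-prefix B)
      where
      decide : ∀ (x y : Factor) → proj₂ x ≤ proj₂ y × (∀ {i} → i < B → w (proj₁ x + i) ≡ w (proj₁ y + i)) → x ≼ y ⊎ z ≼ x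
      decide (q , m) y (m≤ , same) with ≤-<-connex m B
      ... | inj₁ m≤B = inj₁ (0 , s≤s z≤n , m≤ , λ a<m → same (<-≤-trans a<m m≤B))
      ... | inj₂ B<m with occurs q
      ...   | r , r+l≤B , eq = inj₂ (r , s≤s (≤-trans (m≤m+n r l) r+l≤m) , r+l≤m , eq)
        where r+l≤m = ≤-trans r+l≤B (<⇒≤ B<m)

  Forest : Set
  Forest = List Factor

  forest : Forest → Labelled
  forest = ⨁ (λ _ → ⊥) factor

  layers : List Forest → Labelled
  layers = ⨁ (_≡ true) forest

  AF-layers : UniformlyRecurrent w → AF (Sublist (Sublist _≼_))
  AF-layers recurrent = Higman (sublist? _≼?_) (Higman _≼?_ (AF-factor recurrent))

  factor↪line : ∀ x → factor x ↪ LineGraph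
  factor↪line (p , l) = record
    { embeds = record
      { f     = λ a → p + toℕᶠ a
      ; inj   = λ a b e → toℕᶠ-injective (+-cancelˡ-≡ p _ _ e)
      ; pres  = λ a b → consecutive-+ p
      ; refl' = λ a b → consecutive-+⁻ p }
    ; labels = λ _ → refl }

  record Represents (A B : Labelled) (P : V (graph B) → Set) : Set where
    field
      inclusion : A ↪ B
    open _↪_ inclusion public
    field
      within : ∀ v → P (f v)
      onto   : ∀ b → P b → ∃[ v ] f v ≡ b

  module _ (D : ℕ → Set) (D? : ∀ a → Dec (D a)) where

    -- l counts the elements of the interval starting at i that is being read off downwards.
    scan : ℕ → ℕ → Forest
    scan zero    l = (0 , l) ∷ []
    scan (suc i) l with D? i
    ... | yes _ = scan i (suc l)
    -- The missing position `i` closes the interval above it. Adjacent gaps give factors of length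
    -- `0`, which have no vertices.
    ... | no _  = (suc i , l) ∷ scan i 0

    -- The invariant of `scan`: what remains to be read below `i`, together with the pending
    -- interval.
    Scanned : ℕ → ℕ → ℕ → Set
    Scanned i l a = (a < i × D a) ⊎ (i ≤ a × a < i + l)

    scan-represents : ∀ i l → Represents (forest (scan i l)) LineGraph (Scanned i l)
    scan-represents zero l = record
      { inclusion = ⊕-join (λ _ → ⊥) (factor↪line (0 , l)) from-empty (λ _ ()) (λ _ ()) (λ _ ())
      ; within = λ { (inj₁ a) → inj₂ (z≤n , toℕ<n a) ; (inj₂ ()) }
      ; onto = λ { b (inj₂ (_ , b<l)) → inj₁ (fromℕ< b<l) , toℕ-fromℕ< b<l ; b (inj₁ (() , _)) } }
    scan-represents (suc i) l with D? i
    ... | yes Di = record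
      { inclusion = r.inclusion
      ; within = λ v → grow (r.within v)
      ; onto = λ b → r.onto b ∘ shrink }
      where
      module r = Represents (scan-represents i (suc l))
      grow : ∀ {a} → Scanned i (suc l) a → Scanned (suc i) l a
      grow (inj₁ (a<i , Da)) = inj₁ (m≤n⇒m≤1+n a<i , Da)
      grow {a} (inj₂ (i≤a , a<)) with m≤n⇒m<n∨m≡n i≤a
      ... | inj₁ i<a  = inj₂ (i<a , subst (a <_) (+-suc i l) a<)
      ... | inj₂ refl = inj₁ (≤-refl , Di)
      shrink : ∀ {a} → Scanned (suc i) l a → Scanned i (suc l) a
      shrink {a} (inj₁ (a<si , Da)) with m≤n⇒m<n∨m≡n (≤-pred a<si)
      ... | inj₁ a<i  = inj₁ (a<i , Da)
      ... | inj₂ refl = inj₂ (≤-refl , subst (a <_) (sym (+-suc i l)) (s≤s (m≤m+n i l)))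
      shrink {a} (inj₂ (i<a , a<)) = inj₂ (<⇒≤ i<a , subst (a <_) (sym (+-suc i l)) a<)
    ... | no ¬Di = record
      -- Since `i` is missing, the pending interval and the rest are at distance at least two, as a
      -- disjoint union demands.
      { inclusion = ⊕-join (λ _ → ⊥) (factor↪line (suc i , l)) r.inclusion
          (λ x y e → <⇒≱ (gap x y) (≤-trans (≤-reflexive e) (n≤1+n _))) (λ _ _ ()) separate
      ; within = λ { (inj₁ a) → inj₂ (m≤m+n (suc i) (toℕᶠ a) , +-monoʳ-< (suc i) (toℕ<n a)) ; (inj₂ v) → inj₁ (old v) }
      ; onto = onto }
      where
      module r = Represents (scan-represents i 0)
      old : ∀ v → r.f v < suc i × D (r.f v)
      old v with r.within v
      ... | inj₁ (<i , Dv) = m≤n⇒m≤1+n <i , Dv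
      ... | inj₂ (i≤ , <i) = ⊥-elim (<⇒≱ <i (≤-trans (≤-reflexive (+-identityʳ i)) i≤))
      below : ∀ v → r.f v < i
      below v with r.within v
      ... | inj₁ (<i , _) = <i
      ... | inj₂ (i≤ , <i) = ⊥-elim (<⇒≱ <i (≤-trans (≤-reflexive (+-identityʳ i)) i≤))
      gap : ∀ (x : Fin l) y → suc (r.f y) < suc i + toℕᶠ x
      gap x y = ≤-trans (s≤s (below y)) (m≤m+n (suc i) (toℕᶠ x))
      separate : ∀ (x : Fin l) y → ¬ Consecutive (suc i + toℕᶠ x) (r.f y)
      separate x y (inj₁ e) = <-irrefl (sym e) (gap x y)
      separate x y (inj₂ e) = <⇒≱ (gap x y) (≤-trans (n≤1+n _) (≤-trans (≤-reflexive (sym e)) (n≤1+n _)))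
      onto : ∀ b → Scanned (suc i) l b → ∃[ v ] [ (λ a → suc i + toℕᶠ a) , r.f ]′ v ≡ b
      onto b (inj₁ (b<si , Db)) with m≤n⇒m<n∨m≡n (≤-pred b<si)
      ... | inj₂ refl = ⊥-elim (¬Di Db)
      ... | inj₁ b<i with r.onto b (inj₁ (b<i , Db))
      ...   | v , e = inj₂ v , e
      onto b (inj₂ (i<b , b<)) = inj₁ (fromℕ< b∸) , trans (cong (suc i +_) (toℕ-fromℕ< b∸)) (m+[n∸m]≡n i<b)
        where
        b∸ : b ∸ suc i < l
        b∸ = +-cancelˡ-< (suc i) _ _ (≤-trans (s≤s (≤-reflexive (m+[n∸m]≡n i<b))) b<)

  module _ (D : Σ ℕ Fin → Set) (D? : ∀ x → Dec (D x)) where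

    At : ℕ → ℕ → Set
    At i a = Σ (a < i) λ a<i → D (i , fromℕ< a<i)

    At? : ∀ i a → Dec (At i a)
    At? i a with a <? i
    ... | no a≮i = no (a≮i ∘ proj₁)
    ... | yes a<i with D? (i , fromℕ< a<i)
    ...   | yes d = yes (a<i , d)
    ...   | no ¬d = no λ { (a<i′ , d) → ¬d (subst (λ h → D (i , fromℕ< h)) (<-irrelevant a<i′ a<i) d) }

    -- The highest level comes first because the labels of the left summand of `⊕` decide the cross
    -- edges.
    stack : ℕ → List Forest
    stack zero    = []
    stack (suc N) = scan (At N) (At? N) N 0 ∷ stack N

    level-represents : ∀ i → Represents (forest (scan (At i) (At? i) i 0)) LayeredGraph (λ x → level x ≡ i × D x)
    level-represents i = record
      { inclusion = record
        { embeds = record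
          { f = place
          ; inj = λ u v e → r.inj u v (trans (sym (pos-place u)) (trans (cong pos e) (pos-place v)))
          ; pres = λ u v c → side refl (subst₂ Consecutive (sym (pos-place u)) (sym (pos-place v)) (r.pres u v c))
          ; refl' = λ u v c → r.refl' u v (subst₂ Consecutive (pos-place u) (pos-place v) (Adj-level refl c)) }
        ; labels = λ v → trans (cong w (pos-place v)) (r.labels v) }
      ; within = λ v → refl , proj₂ (member v)
      ; onto = onto }
      where
      module r = Represents (scan-represents (At i) (At? i) i 0)
      member : ∀ v → At i (r.f v)
      member v with r.within v
      ... | inj₁ (_ , d)   = d
      ... | inj₂ (i≤ , <i) = ⊥-elim (<⇒≱ <i (≤-trans (≤-reflexive (+-identityʳ i)) i≤))
      place : V (graph (forest (scan (At i) (At? i) i 0))) → Σ ℕ Fin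
      place v = i , fromℕ< (proj₁ (member v))
      pos-place : ∀ v → pos (place v) ≡ r.f v
      pos-place v = toℕ-fromℕ< (proj₁ (member v))
      onto : ∀ x → level x ≡ i × D x → ∃[ v ] place v ≡ x
      onto (.i , a) (refl , d) with r.onto (toℕᶠ a) (inj₁ (toℕ<n a , toℕ<n a , subst (λ z → D (i , z)) (sym (fromℕ<-toℕ a (toℕ<n a))) d))
      ... | v , e = v , level-pos-injective refl (trans (pos-place v) e)

    stack-represents : ∀ N → Represents (layers (stack N)) LayeredGraph (λ x → level x < N × D x)
    stack-represents zero = record { inclusion = from-empty ; within = λ () ; onto = λ _ () }
    stack-represents (suc N) = record
      { inclusion = ⊕-join (_≡ true) top.inclusion rest.inclusion
          (λ x y e → <-irrefl (cong level (sym e)) (lower x y))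
          (λ x y lab → down (lower x y) (trans (top.labels x) lab))
          (λ x y e → trans (sym (top.labels x)) (Adj-downward (lower x y) e))
      ; within = λ { (inj₁ v) → s≤s (≤-reflexive (proj₁ (top.within v))) , proj₂ (top.within v)
                   ; (inj₂ v) → m≤n⇒m≤1+n (proj₁ (rest.within v)) , proj₂ (rest.within v) }
      ; onto = onto }
      where
      module top = Represents (level-represents N)
      module rest = Represents (stack-represents N)
      lower : ∀ x y → level (rest.f y) < level (top.f x)
      lower x y = subst (level (rest.f y) <_) (sym (proj₁ (top.within x))) (proj₁ (rest.within y))
      onto : ∀ x → level x < suc N × D x → ∃[ v ] [ top.f , rest.f ]′ v ≡ x
      onto x (x<sN , d) with m≤n⇒m<n∨m≡n (≤-pred x<sN)
      ... | inj₁ x<N = let v , e = rest.onto x (x<N , d) in inj₂ v , e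
      ... | inj₂ x≡N = let v , e = top.onto x (x≡N , d) in inj₁ v , e

  bounded : ∀ {n} (g : Fin n → ℕ) → ∃[ N ] (∀ k → g k < N)
  bounded {zero}  g = 0 , λ ()
  bounded {suc n} g with bounded (g ∘ suc)
  ... | N , h = suc (g zero) ⊔ N , λ { zero → m≤m⊔n (suc (g zero)) N ; (suc k) → ≤-trans (h k) (m≤n⊔m (suc (g zero)) N) }

  -- The image of `F` meets finitely many levels and is decidable, so it can be read off as a stack.
  -- Both graphs then have the same image in `Layered w`, hence embed in each other.
  InAge⇒layers : ∀ F → InAge (Layered w) F →
                 ∃[ C ] (Embeds (toGraph F) (graph (layers C)) × Embeds (graph (layers C)) (toGraph F))
  InAge⇒layers F e = stack Image Image? N
    , image-⊆⇒embeds e (embeds S.inclusion) (λ k → S.onto (f k) (f<N k , k , refl))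
    , image-⊆⇒embeds (embeds S.inclusion) e (λ v → proj₂ (S.within v))
    where
    open Embedding e
    Image : Σ ℕ Fin → Set
    Image x = ∃[ k ] f k ≡ x
    Image? : ∀ x → Dec (Image x)
    Image? x = any? λ k → ≡-dec _≟ⁿ_ _≟ᶠ_ (f k) x
    N : ℕ
    N = proj₁ (bounded (level ∘ f))
    f<N : ∀ k → level (f k) < N
    f<N = proj₂ (bounded (level ∘ f))
    module S = Represents (stack-represents Image Image? N)

  Layered-AgeWQO : UniformlyRecurrent w → AgeWQO (Layered w)
  Layered-AgeWQO recurrent (F , inAge , antichain) with AF-good-pair (AF-layers recurrent) (λ i → proj₁ (InAge⇒layers (F i) (inAge i)))
  ... | i , j , i<j , s = antichain i j (<⇒≢ i<j)
    ( proj₂ (proj₂ (InAge⇒layers (F j) (inAge j)))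
    ⊙ (embeds (⨁-mono (_≡ true) forest (⨁-mono (λ _ → ⊥) factor ≼⇒↪) s)
    ⊙ proj₁ (proj₂ (InAge⇒layers (F i) (inAge i)))))

theorem11 : Σ ((ℕ → Bool) → Graph) λ G →
    (∀ s → PathMinimal (G s) × ¬ Prime (G s) × AgeWQO (G s)
    × (∀ (H : Graph) → Equimorphic H (G s) → ¬ Prime H)) ×
    (∀ s t → Apart s t → ¬ AgeSubset (G s) (G t) × ¬ AgeSubset (G t) (G s))
theorem11 = (λ s → Layered (word s))
  , (λ s → Layered-PathMinimal (recurrent s)
         , not-prime s (Layered (word s)) (idEmbedding (Layered (word s)) , idEmbedding (Layered (word s)))
         , Layered-AgeWQO (word s) (recurrent s)
         , not-prime s)
  , (λ { s t (k , sk≢tk) → distinguished s t k sk≢tk , distinguished t s k (sk≢tk ∘ sym) })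
  where
  word : Seq → Seq
  word s = toeplitz (interleave¬ s)
  recurrent : ∀ s → UniformlyRecurrent (word s)
  recurrent s = toeplitz-recurrent (interleave¬ s)
  not-prime : ∀ s H → Equimorphic H (Layered (word s)) → ¬ Prime H
  not-prime s = Layered-equimorphic-not-prime (word s)
  distinguished : ∀ s t k → s k ≢ t k → ¬ AgeSubset (Layered (word s)) (Layered (word t))
  distinguished s t k ne = age-distinguishes (interleave¬-noTriple s) (interleave¬-noTriple t) (k + k)
    (λ e → ne (trans (sym (interleave¬-even s k)) (trans e (interleave¬-even t k))))
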